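{- Let $p$ be a prime with $p\equiv 3\pmod 4$, let $t\geq 1$ be an integer, $q=p^{2t}$ and $r=\frac{q-1}{4}$. The Smith group of the Peisert graph $P^*(q)$, i.e. the cokernel of its adjacency matrix $A$ viewed as a map $\mathbb{Z}^{\mathbb{F}_q}\to\mathbb{Z}^{\mathbb{F}_q}$, is isomorphic to $\mathbb{Z}/2r\mathbb{Z}\oplus(\mathbb{Z}/r\mathbb{Z})^{2r}$.
   Context: Let $\beta$ be a primitive element of $\mathbb{F}_q$, let $C_0$ be the subgroup of nonzero fourth powers in $\mathbb{F}_q^\times$, $C_1=\beta C_0$ and $S'=C_0\cup C_1$. The Peisert graph $P^*(q)$ has vertex set $\mathbb{F}_q$, two distinct vertices $x,y$ being adjacent iff $x-y\in S'$ (its isomorphism type does not depend on $\beta$). Its adjacency matrix $A$ is taken with respect to any fixed ordering of $\mathbb{F}_q$. -}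

module Defs where

open import Level using (0ℓ)
open import Data.Nat as ℕ using (ℕ; zero; suc)
open import Data.Integer as ℤ using (ℤ; +_)
open import Data.Integer.Divisibility using (_∣_)
open import Data.Fin using (Fin; zero; suc)
open import Data.Product using (_×_; ∃; ∃-syntax; Σ-syntax)
open import Data.Sum using (_⊎_)
open import Relation.Nullary using (¬_)
open import Relation.Binary.PropositionalEquality using (_≡_; _≢_)
open import Function.Bundles using (_↔_; Inverse)
open import Algebra.Core using (Op₁; Op₂)
open import Algebra.Structures using (IsCommutativeRing)
open import Algebra.Bundles.Raw using (RawGroup)

record FiniteField (q : ℕ) : Set₁ where
  infixl 7 _*_
  infixl 6 _+_ _-_
  field
    Carrier           : Set
    _+_ _*_           : Op₂ Carrier
    -_                : Op₁ Carrier
    0# 1#             : Carrier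
    isCommutativeRing : IsCommutativeRing _≡_ _+_ _*_ -_ 0# 1#
    0≢1               : 0# ≢ 1#
    inverse           : ∀ x → x ≢ 0# → ∃[ y ] (x * y ≡ 1#)
    enum              : Fin q ↔ Carrier

  _-_ : Op₂ Carrier
  x - y = x + (- y)

  _^_ : Carrier → ℕ → Carrier
  x ^ zero  = 1#
  x ^ suc k = x * (x ^ k)

  IsPrimitive : Carrier → Set
  IsPrimitive β = β ≢ 0# × (∀ x → x ≢ 0# → ∃[ k ] (β ^ k ≡ x))

  C₀ : Carrier → Set
  C₀ x = x ≢ 0# × ∃[ y ] (y ^ 4 ≡ x)

  C₁ : Carrier → Carrier → Set
  C₁ β x = ∃[ c ] (C₀ c × x ≡ β * c)

  S' : Carrier → Carrier → Set
  S' β x = C₀ x ⊎ C₁ β x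

  PeisertAdj : Carrier → Carrier → Carrier → Set
  PeisertAdj β x y = x ≢ y × S' β (x - y)

  elt : Fin q → Carrier
  elt = Inverse.to enum

  IsPeisertAdjMatrix : Carrier → (Fin q → Fin q → ℤ) → Set
  IsPeisertAdjMatrix β A =
    ∀ i j → (PeisertAdj β (elt i) (elt j) → A i j ≡ + 1)
          × (¬ PeisertAdj β (elt i) (elt j) → A i j ≡ + 0)

sumℤ : ∀ {n} → (Fin n → ℤ) → ℤ
sumℤ {zero}  f = + 0
sumℤ {suc n} f = f zero ℤ.+ sumℤ (λ i → f (suc i))

Coker : (n : ℕ) → (Fin n → Fin n → ℤ) → RawGroup 0ℓ 0ℓ
Coker n M = record
  { Carrier = Fin n → ℤ
  ; _≈_     = λ u v → Σ[ w ∈ (Fin n → ℤ) ] (∀ i → u i ℤ.- v i ≡ sumℤ (λ j → M i j ℤ.* w j))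
  ; _∙_     = λ u v i → u i ℤ.+ v i
  ; ε       = λ _ → + 0
  ; _⁻¹     = λ u i → ℤ.- u i
  }

CyclicSum : (k : ℕ) → (Fin k → ℕ) → RawGroup 0ℓ 0ℓ
CyclicSum k m = record
  { Carrier = Fin k → ℤ
  ; _≈_     = λ u v → ∀ i → (+ m i) ∣ (u i ℤ.- v i)
  ; _∙_     = λ u v i → u i ℤ.+ v i
  ; ε       = λ _ → + 0
  ; _⁻¹     = λ u i → ℤ.- u i
  }

targetModuli : (r : ℕ) → Fin (suc (2 ℕ.* r)) → ℕ
targetModuli r zero    = 2 ℕ.* r
targetModuli r (suc _) = r

Target : ℕ → RawGroup 0ℓ 0ℓ
Target r = CyclicSum (suc (2 ℕ.* r)) (targetModuli r)

{-# OPTIONS --safe #-}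

-- With q = 4r + 1, the adjacency matrix satisfies A² = r(I + J) − A and has all
-- row and column sums equal to 2r. This holds because multiplication by C₀ and
-- the additive map x ↦ βx^p act transitively on S′ and on its complement in
-- F^×, while multiplication by β² interchanges the two.
--
-- Write r = θ(θ+1), τ = −1−θ. On vectors of sum zero A has the eigenvalues θ
-- and τ, and q times the projections onto the two eigenspaces are integer
-- matrices P of rank 2r (the rank is read off the trace). Since ℤ is a PID they
-- factor as P = XY with YX = q. As r is prime to q, the map
-- sending u to its coordinate sum modulo 2r and to θY₂u − τY₁u modulo r, with
-- Y₁ and Y₂ for the eigenvalues θ and τ, induces the isomorphism.
module Submission where

open import Defs
open import Algebra.Bundles using (CommutativeRing)
open import Algebra.Morphism.Structures using (module GroupMorphisms)
import Algebra.Properties.CommutativeSemigroup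
import Algebra.Properties.CommutativeSemiring.Binomial
import Algebra.Properties.Group
import Algebra.Properties.Ring
import Algebra.Properties.Semiring.Exp
import Algebra.Properties.Semiring.Mult
import Algebra.Properties.Semiring.Sum
open import Data.Fin as Fin using (Fin; zero; suc; toℕ; fromℕ; fromℕ<; inject₁; punchOut)
open import Data.Fin.Patterns using (0F; 1F; 2F; 3F)
import Data.Fin.Properties as Fin
open import Data.Integer as ℤ using (ℤ; +_; -[1+_]; 0ℤ; 1ℤ)
open import Data.Integer.Divisibility.Signed as ℤ using (divides; ∣⇒∣ᵤ; ∣ᵤ⇒∣)
import Data.Integer.Properties as ℤ
open import Data.Integer.Tactic.RingSolver using (solve-∀)
open import Data.Nat as ℕ using (ℕ; zero; suc; s≤s; z≤n; _!)
open import Data.Nat.Combinatorics using (_C_; nCk≡n!/k![n-k]!; k![n∸k]!∣n!; nCn≡1)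
import Data.Nat.Divisibility as ℕ
import Data.Nat.DivMod as ℕ
import Data.Nat.GCD as ℕ
open import Data.Nat.Primality using (Prime; prime⇒nonZero; euclidsLemma; ¬prime[1])
import Data.Nat.Properties as ℕ
import Data.Nat.Tactic.RingSolver as ℕ-Solver
open import Data.Product using (_×_; _,_; proj₁; proj₂; ∃; ∃-syntax; Σ-syntax)
open import Data.Sum using (inj₁; inj₂)
open import Data.Vec.Functional using (Vector; _∷_; head; tail)
open import Function using (_∘_; _↔_; Inverse; mk↔ₛ′)
open import Function.Bundles using (Injection)
open import Function.Construct.Composition using (_↔-∘_)
open import Function.Construct.Symmetry using (↔-sym)
open import Function.Properties.Inverse using (↔⇒↣)
open import Relation.Binary using (DecidableEquality)
open import Relation.Binary.PropositionalEquality
open import Relation.Nullary using (yes; no; contradiction)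
open import Relation.Nullary.Decidable using (via-injection)

open Algebra.Properties.Semiring.Sum (CommutativeRing.semiring ℤ.+-*-commutativeRing)
open ≡-Reasoning

-- The line of `𝟙` and the two eigenlattices need not span the whole lattice; their sum is only
-- known to contain q times it. The factor is harmless because q² ≡ 1 modulo 2r and 2r annihilates
-- the cokernel, so no inverse of q has to be chosen. Since θ + τ = -1, the eigenvalues are coprime:
-- the θ-eigenspace contributes copies of ℤ/θ, the τ-eigenspace copies of ℤ/τ, and as both have rank
-- 2r the Chinese remainder theorem glues them in pairs into copies of ℤ/r. That θ is an integer
-- comes from √q = p^t being odd.

module IntegerLinearAlgebra where
  open import Data.Integer using (_+_; _*_; -_; _-_)

  -- Sums, dot products and matrices over the integers

  sumℤ≡sum : ∀ {n} (f : Vector ℤ n) → sumℤ f ≡ sum f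
  sumℤ≡sum {zero}  f = refl
  sumℤ≡sum {suc n} f = cong (_+_ (f zero)) (sumℤ≡sum (f ∘ suc))

  sum-const : ∀ n c → ∑[ i < n ] c ≡ + n * c
  sum-const zero    c = refl
  sum-const (suc n) c = trans (cong (_+_ c) (sum-const n c)) (solve-suc (+ n) c)
    where
    solve-suc : ∀ n c → c + n * c ≡ (+ 1 + n) * c
    solve-suc = solve-∀

  sum-linear : ∀ {n} a b (u v : Vector ℤ n) →
               ∑[ i < n ] (a * u i + b * v i) ≡ a * sum u + b * sum v
  sum-linear a b u v = begin
    ∑[ i < _ ] (a * u i + b * v i)             ≡⟨ ∑-distrib-+ (λ i → a * u i) (λ i → b * v i) ⟩
    ∑[ i < _ ] (a * u i) + ∑[ i < _ ] (b * v i) ≡⟨ cong₂ _+_ (*-distribˡ-sum a u) (*-distribˡ-sum b v) ⟨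
    a * sum u + b * sum v                      ∎

  Matrix : ℕ → ℕ → Set
  Matrix m n = Fin m → Fin n → ℤ

  infixr 7 _·_
  infix 8 _∙_

  δ : ∀ {n} → Matrix n n
  δ zero    zero    = 1ℤ
  δ zero    (suc _) = 0ℤ
  δ (suc _) zero    = 0ℤ
  δ (suc i) (suc j) = δ i j

  δ-diag : ∀ {n} (i : Fin n) → δ i i ≡ 1ℤ
  δ-diag zero    = refl
  δ-diag (suc i) = δ-diag i

  δ-off : ∀ {n} {i j : Fin n} → i ≢ j → δ i j ≡ 0ℤ
  δ-off {i = zero}  {zero}  i≢j = contradiction refl i≢j
  δ-off {i = zero}  {suc _} _   = refl
  δ-off {i = suc _} {zero}  _   = refl
  δ-off {i = suc _} {suc _} i≢j = δ-off (i≢j ∘ cong suc)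

  opaque
    -- Opaque, so that goals keep dot products as atoms and never unfold into sums; `∙-sum` and
    -- `∙-suc` are the ways in.
    _∙_ : ∀ {n} → Vector ℤ n → Vector ℤ n → ℤ
    u ∙ v = ∑[ j < _ ] (u j * v j)

    ∙-sum : ∀ {n} (u v : Vector ℤ n) → u ∙ v ≡ ∑[ j < n ] (u j * v j)
    ∙-sum u v = refl

    ∙-suc : ∀ {n} (u v : Vector ℤ (suc n)) → u ∙ v ≡ head u * head v + tail u ∙ tail v
    ∙-suc u v = refl

    ∙-congˡ : ∀ {n} (a : Vector ℤ n) {u v} → u ≗ v → a ∙ u ≡ a ∙ v
    ∙-congˡ a u≗v = sum-cong-≗ (λ j → cong (a j *_) (u≗v j))

    ∙-comm : ∀ {n} (u v : Vector ℤ n) → u ∙ v ≡ v ∙ u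
    ∙-comm u v = sum-cong-≗ (λ j → ℤ.*-comm (u j) (v j))

    -- Linear combinations keep the shape a x + b y, with coefficients ±1 written
    -- out, so that bilinearity applies to them syntactically.
    ∙-linearˡ : ∀ {n} a b (u v w : Vector ℤ n) →
                (λ j → a * u j + b * v j) ∙ w ≡ a * u ∙ w + b * v ∙ w
    ∙-linearˡ a b u v w = trans
      (sum-cong-≗ (λ j → rearrange a b (u j) (v j) (w j)))
      (sum-linear a b (λ j → u j * w j) (λ j → v j * w j))
      where
      rearrange : ∀ a b x y z → (a * x + b * y) * z ≡ a * (x * z) + b * (y * z)
      rearrange = solve-∀

    ∙-scaleʳ : ∀ {n} c (w u : Vector ℤ n) → w ∙ (λ j → c * u j) ≡ c * w ∙ u
    ∙-scaleʳ c w u = trans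
      (sum-cong-≗ (λ j → rearrange c (w j) (u j)))
      (sym (*-distribˡ-sum c (λ j → w j * u j)))
      where
      rearrange : ∀ c x y → x * (c * y) ≡ c * (x * y)
      rearrange = solve-∀

  ∙-linearʳ : ∀ {n} a b (w u v : Vector ℤ n) →
              w ∙ (λ j → a * u j + b * v j) ≡ a * w ∙ u + b * w ∙ v
  ∙-linearʳ a b w u v = begin
    w ∙ (λ j → a * u j + b * v j)  ≡⟨ ∙-comm w _ ⟩
    (λ j → a * u j + b * v j) ∙ w  ≡⟨ ∙-linearˡ a b u v w ⟩
    a * u ∙ w + b * v ∙ w          ≡⟨ cong₂ (λ x y → a * x + b * y) (∙-comm u w) (∙-comm v w) ⟩
    a * w ∙ u + b * w ∙ v          ∎

  ∙-zeroʳ : ∀ {n} (w : Vector ℤ n) → w ∙ (λ _ → 0ℤ) ≡ 0ℤ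
  ∙-zeroʳ w = ∙-scaleʳ 0ℤ w (λ _ → 0ℤ)

  ∙-zeroˡ : ∀ {n} (w : Vector ℤ n) → (λ _ → 0ℤ) ∙ w ≡ 0ℤ
  ∙-zeroˡ w = trans (∙-comm _ w) (∙-zeroʳ w)

  ∙-basisʳ : ∀ {n} (w : Vector ℤ n) i → w ∙ (λ j → δ j i) ≡ w i
  ∙-basisʳ w zero = begin
    w ∙ (λ j → δ j zero)               ≡⟨ ∙-suc w _ ⟩
    w zero * 1ℤ + tail w ∙ (λ _ → 0ℤ)  ≡⟨ cong₂ _+_ (ℤ.*-identityʳ (w zero)) (∙-zeroʳ (tail w)) ⟩
    w zero + 0ℤ                        ≡⟨ ℤ.+-identityʳ (w zero) ⟩
    w zero                             ∎
  ∙-basisʳ w (suc i) = begin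
    w ∙ (λ j → δ j (suc i))               ≡⟨ ∙-suc w _ ⟩
    w zero * 0ℤ + tail w ∙ (λ j → δ j i)  ≡⟨ cong₂ _+_ (ℤ.*-zeroʳ (w zero)) (∙-basisʳ (tail w) i) ⟩
    0ℤ + w (suc i)                        ≡⟨ ℤ.+-identityˡ (w (suc i)) ⟩
    w (suc i)                             ∎

  _·_ : ∀ {m n} → Matrix m n → Vector ℤ n → Vector ℤ m
  (M · u) i = M i ∙ u

  -- Interchange of two sums. The entries of the product matrix stay dot products, the form in which
  -- `square` and `columnSum` supply them.
  ·-assoc : ∀ {l m n} (M : Matrix l m) (N : Matrix m n) u i →
            (M · N · u) i ≡ (λ k → M i ∙ (λ j → N j k)) ∙ u
  ·-assoc M N u i = begin
    M i ∙ (N · u)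
      ≡⟨ ∙-sum (M i) (N · u) ⟩
    ∑[ j < _ ] (M i j * N j ∙ u)
      ≡⟨ sum-cong-≗ (λ j → trans (cong (M i j *_) (∙-sum (N j) u)) (*-distribˡ-sum (M i j) (λ k → N j k * u k))) ⟩
    ∑[ j < _ ] ∑[ k < _ ] (M i j * (N j k * u k))
      ≡⟨ ∑-comm (λ j k → M i j * (N j k * u k)) ⟩
    ∑[ k < _ ] ∑[ j < _ ] (M i j * (N j k * u k))
      ≡⟨ sum-cong-≗ (λ k → sum-cong-≗ (λ j → sym (ℤ.*-assoc (M i j) (N j k) (u k)))) ⟩
    ∑[ k < _ ] ∑[ j < _ ] (M i j * N j k * u k)
      ≡⟨ sum-cong-≗ (λ k → *-distribʳ-sum (u k) (λ j → M i j * N j k)) ⟨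
    ∑[ k < _ ] (∑[ j < _ ] (M i j * N j k) * u k)
      ≡⟨ sum-cong-≗ (λ k → cong (_* u k) (∙-sum (M i) (λ j → N j k))) ⟨
    ∑[ k < _ ] (M i ∙ (λ j → N j k) * u k)
      ≡⟨ ∙-sum (λ k → M i ∙ (λ j → N j k)) u ⟨
    (λ k → M i ∙ (λ j → N j k)) ∙ u
      ∎

  ∙-congʳ : ∀ {n} {u v : Vector ℤ n} w → u ≗ v → u ∙ w ≡ v ∙ w
  ∙-congʳ {u = u} {v} w u≗v = trans (∙-comm u w) (trans (∙-congˡ w u≗v) (∙-comm w v))

  𝟙 : ∀ {n} → Vector ℤ n
  𝟙 _ = 1ℤ

  𝟙∙𝟙≡n : ∀ n → 𝟙 {n} ∙ 𝟙 ≡ + n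
  𝟙∙𝟙≡n n = begin
    𝟙 {n} ∙ 𝟙       ≡⟨ ∙-sum 𝟙 𝟙 ⟩
    ∑[ i < n ] 1ℤ   ≡⟨ sum-const n 1ℤ ⟩
    + n * 1ℤ        ≡⟨ ℤ.*-identityʳ (+ n) ⟩
    + n             ∎

  δ-sym : ∀ {n} (i j : Fin n) → δ i j ≡ δ j i
  δ-sym zero    zero    = refl
  δ-sym zero    (suc _) = refl
  δ-sym (suc _) zero    = refl
  δ-sym (suc i) (suc j) = δ-sym i j

  ∙-basisˡ : ∀ {n} i (w : Vector ℤ n) → δ i ∙ w ≡ w i
  ∙-basisˡ i w = begin
    δ i ∙ w            ≡⟨ ∙-comm (δ i) w ⟩
    w ∙ δ i            ≡⟨ ∙-congˡ w (δ-sym i) ⟩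
    w ∙ (λ j → δ j i)  ≡⟨ ∙-basisʳ w i ⟩
    w i                ∎

  trace-comm : ∀ {m n} (M : Matrix m n) (N : Matrix n m) →
               ∑[ i < m ] (M i ∙ (λ j → N j i)) ≡ ∑[ j < n ] (N j ∙ (λ i → M i j))
  trace-comm M N = begin
    ∑[ i < _ ] (M i ∙ (λ j → N j i))          ≡⟨ sum-cong-≗ (λ i → ∙-sum (M i) _) ⟩
    ∑[ i < _ ] ∑[ j < _ ] (M i j * N j i)     ≡⟨ ∑-comm (λ i j → M i j * N j i) ⟩
    ∑[ j < _ ] ∑[ i < _ ] (M i j * N j i)     ≡⟨ sum-cong-≗ (λ j → sum-cong-≗ (λ i → ℤ.*-comm (M i j) (N j i))) ⟩
    ∑[ j < _ ] ∑[ i < _ ] (N j i * M i j)     ≡⟨ sum-cong-≗ (λ j → ∙-sum (N j) _) ⟨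
    ∑[ j < _ ] (N j ∙ (λ i → M i j))          ∎

  -- Greatest common divisors and factorization of integer matrices

  bézout-ℕ : ∀ m n → ∃[ u ] ∃[ v ] u * + m + v * + n ≡ + ℕ.gcd m n
  bézout-ℕ m n with ℕ.Bézout.identity (ℕ.gcd-GCD m n)
  ... | ℕ.Bézout.+- x y eq = + x , - + y , (begin
    + x * + m + - + y * + n             ≡⟨ cong (_+ - + y * + n) (ℤ.pos-* x m) ⟨
    + (x ℕ.* m) + - + y * + n           ≡⟨ cong (λ z → + z + - + y * + n) eq ⟨
    + (ℕ.gcd m n ℕ.+ y ℕ.* n) + - + y * + n
      ≡⟨ cong (_+ - + y * + n) (trans (ℤ.pos-+ (ℕ.gcd m n) _) (cong (_+_ (+ ℕ.gcd m n)) (ℤ.pos-* y n))) ⟩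
    + ℕ.gcd m n + + y * + n + - + y * + n ≡⟨ cancel (+ ℕ.gcd m n) (+ y) (+ n) ⟩
    + ℕ.gcd m n ∎)
    where
    cancel : ∀ d y n → d + y * n + - y * n ≡ d
    cancel = solve-∀
  ... | ℕ.Bézout.-+ x y eq = - + x , + y , (begin
    - + x * + m + + y * + n             ≡⟨ cong (_+_ (- + x * + m)) (ℤ.pos-* y n) ⟨
    - + x * + m + + (y ℕ.* n)           ≡⟨ cong (λ z → - + x * + m + + z) eq ⟨
    - + x * + m + + (ℕ.gcd m n ℕ.+ x ℕ.* m)
      ≡⟨ cong (_+_ (- + x * + m)) (trans (ℤ.pos-+ (ℕ.gcd m n) _) (cong (_+_ (+ ℕ.gcd m n)) (ℤ.pos-* x m))) ⟩
    - + x * + m + (+ ℕ.gcd m n + + x * + m) ≡⟨ cancel (+ ℕ.gcd m n) (+ x) (+ m) ⟩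
    + ℕ.gcd m n ∎)
    where
    cancel : ∀ d x m → - x * m + (d + x * m) ≡ d
    cancel = solve-∀

  -- The sign is kept as a factor of square 1, so it can be moved across an equation and zero is no
  -- exception.
  ∣i∣-associated : ∀ i → ∃[ ε ] (ε * ε ≡ 1ℤ × i ≡ ε * + ℤ.∣ i ∣)
  ∣i∣-associated (+ n)    = 1ℤ , refl , sym (ℤ.*-identityˡ (+ n))
  ∣i∣-associated -[1+ n ] = - 1ℤ , refl , sym (ℤ.-1*i≡-i (+ suc n))

  opaque
    -- The cofactors a′ and b′ are returned because g may be 0, when division could not recover
    -- them.
    bézout : ∀ a b → ∃[ g ] ∃[ u ] ∃[ v ] ∃[ a′ ] ∃[ b′ ]
             (u * a + v * b ≡ g × a ≡ g * a′ × b ≡ g * b′)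
    bézout a b
      with ε , ε²≡1 , a≡ε∣a∣ ← ∣i∣-associated a
         | η , η²≡1 , b≡η∣b∣ ← ∣i∣-associated b
         | u , v , eq ← bézout-ℕ ℤ.∣ a ∣ ℤ.∣ b ∣
         | ℕ.divides x a≡xg ← ℕ.gcd[m,n]∣m ℤ.∣ a ∣ ℤ.∣ b ∣
         | ℕ.divides y b≡yg ← ℕ.gcd[m,n]∣n ℤ.∣ a ∣ ℤ.∣ b ∣
      = g , u * ε , v * η , ε * + x , η * + y
      , (begin
          u * ε * a + v * η * b
            ≡⟨ cong₂ (λ i j → u * ε * i + v * η * j) a≡ε∣a∣ b≡η∣b∣ ⟩
          u * ε * (ε * + ℤ.∣ a ∣) + v * η * (η * + ℤ.∣ b ∣)
            ≡⟨ regroup u v ε η (+ ℤ.∣ a ∣) (+ ℤ.∣ b ∣) ⟩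
          ε * ε * (u * + ℤ.∣ a ∣) + η * η * (v * + ℤ.∣ b ∣)
            ≡⟨ cong₂ (λ i j → i * (u * + ℤ.∣ a ∣) + j * (v * + ℤ.∣ b ∣)) ε²≡1 η²≡1 ⟩
          1ℤ * (u * + ℤ.∣ a ∣) + 1ℤ * (v * + ℤ.∣ b ∣)
            ≡⟨ cong₂ _+_ (ℤ.*-identityˡ (u * + ℤ.∣ a ∣)) (ℤ.*-identityˡ (v * + ℤ.∣ b ∣)) ⟩
          u * + ℤ.∣ a ∣ + v * + ℤ.∣ b ∣
            ≡⟨ eq ⟩
          g ∎)
      , trans a≡ε∣a∣ (multiple ε x a≡xg)
      , trans b≡η∣b∣ (multiple η y b≡yg)
      where
      g : ℤ
      g = + ℕ.gcd ℤ.∣ a ∣ ℤ.∣ b ∣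
      regroup : ∀ u v ε η a b → u * ε * (ε * a) + v * η * (η * b) ≡ ε * ε * (u * a) + η * η * (v * b)
      regroup = solve-∀
      multiple : ∀ ε x {n} → n ≡ x ℕ.* ℕ.gcd ℤ.∣ a ∣ ℤ.∣ b ∣ → ε * + n ≡ g * (ε * + x)
      multiple ε x refl = trans (cong (ε *_) (ℤ.pos-* x _)) (swap ε (+ x) g)
        where
        swap : ∀ ε x g → ε * (x * g) ≡ g * (ε * x)
        swap = solve-∀

  -- The entries of `a` generate the ideal of g: z certifies one inclusion, y the other.
  gcd-vector : ∀ {m} (a : Vector ℤ m) →
               Σ[ g ∈ ℤ ] Σ[ z ∈ Vector ℤ m ] Σ[ y ∈ Vector ℤ m ] (a ∙ z ≡ g × ∀ j → a j ≡ g * y j)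
  -- The empty vector generates the zero ideal; writing its generator as `a ∙ a` makes the equation
  -- `refl` although `∙` is opaque.
  gcd-vector {zero}  a = a ∙ a , a , a , refl , λ ()
  gcd-vector {suc m} a
    with g′ , z′ , y′ , a∙z≡g′ , a≡g′y′ ← gcd-vector (tail a)
    with g , u , v , b , c , eq , a₀≡gb , g′≡gc ← bézout (a zero) g′
    = g , z , y , a∙z≡g , a≡gy
    where
    z y : Vector ℤ (suc m)
    z = u ∷ (λ j → v * z′ j)
    y = b ∷ (λ j → c * y′ j)
    a∙z≡g : a ∙ z ≡ g
    a∙z≡g = begin
      a ∙ z                                   ≡⟨ ∙-suc a z ⟩
      a zero * u + tail a ∙ (λ j → v * z′ j)  ≡⟨ cong₂ _+_ (ℤ.*-comm (a zero) u) (∙-scaleʳ v (tail a) z′) ⟩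
      u * a zero + v * tail a ∙ z′            ≡⟨ cong (λ x → u * a zero + v * x) a∙z≡g′ ⟩
      u * a zero + v * g′                     ≡⟨ eq ⟩
      g                                       ∎
    a≡gy : ∀ j → a j ≡ g * y j
    a≡gy zero    = a₀≡gb
    a≡gy (suc j) = begin
      a (suc j)       ≡⟨ a≡g′y′ j ⟩
      g′ * y′ j       ≡⟨ cong (_* y′ j) g′≡gc ⟩
      g * c * y′ j    ≡⟨ ℤ.*-assoc g c (y′ j) ⟩
      g * (c * y′ j)  ∎

  -- The columns of X form a ℤ-basis of the image of P, and Y gives the coordinates of P u in it.
  -- Surjectivity of Y over ℤ, not merely over ℚ, lets relations for P pass to Y X.
  record RankFactorization {n m} (P : Matrix n m) : Set where
    field
      rank       : ℕ
      X          : Matrix n rank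
      Y          : Matrix rank m
      factors    : ∀ u → P · u ≗ X · Y · u
      injective  : ∀ v → (∀ i → (X · v) i ≡ 0ℤ) → ∀ i → v i ≡ 0ℤ
      surjective : ∀ w → Σ[ z ∈ Vector ℤ m ] Y · z ≗ w

  -- The image of P is split along its first coordinate: x₀ is an element of the
  -- image whose first coordinate generates the ideal of all first coordinates.
  rankFactorization : ∀ {n m} (P : Matrix n m) → RankFactorization P
  rankFactorization {zero} P = record
    { rank = 0 ; X = λ () ; Y = λ () ; factors = λ _ () ; injective = λ _ _ ()
    ; surjective = λ _ → (λ _ → 0ℤ) , λ () }
  rankFactorization {suc n} {m} P
    with g , z , y , a∙z≡g , a≡gy ← gcd-vector (P zero)
    -- For g = 0 the first row of P vanishes and no basis vector is added; otherwise the rank grows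
    -- by one.
    with g ℤ.≟ 0ℤ
  ... | yes refl = record
    { rank = rank ; X = (λ _ → 0ℤ) ∷ X ; Y = Y
    ; factors = factors⁺
    ; injective = λ v Xv≡0 → injective v (Xv≡0 ∘ suc)
    ; surjective = surjective }
    where
    open RankFactorization (rankFactorization (tail P))
    factors⁺ : ∀ u → P · u ≗ ((λ _ → 0ℤ) ∷ X) · Y · u
    factors⁺ u zero = begin
      P zero ∙ u             ≡⟨ ∙-comm (P zero) u ⟩
      u ∙ P zero             ≡⟨ ∙-congˡ u a≡gy ⟩
      u ∙ (λ _ → 0ℤ)         ≡⟨ ∙-zeroʳ u ⟩
      0ℤ                     ≡⟨ ∙-zeroˡ (Y · u) ⟨
      (λ _ → 0ℤ) ∙ (Y · u)   ∎
    factors⁺ u (suc i) = factors u i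
  ... | no g≢0 = record
    { rank = suc rank ; X = X⁺ ; Y = y ∷ Y
    ; factors = factors⁺ ; injective = injective⁺ ; surjective = surjective⁺ }
    where
    instance _ = ℤ.≢-nonZero g≢0
    x₀ : Vector ℤ n
    x₀ = tail P · z
    -- Subtracting `y ∙ u` times P z, the vector with entries g and x₀, clears the first coordinate
    -- of P u; P′ is what remains in the others.
    P′ : Matrix n m
    P′ i j = 1ℤ * P (suc i) j + - x₀ i * y j
    P′-spec : ∀ u i → (P′ · u) i ≡ 1ℤ * (tail P · u) i + - x₀ i * y ∙ u
    P′-spec u i = ∙-linearˡ 1ℤ (- x₀ i) (P (suc i)) y u
    open RankFactorization (rankFactorization P′)
    X⁺ : Matrix (suc n) (suc rank)
    X⁺ = (g ∷ (λ _ → 0ℤ)) ∷ (λ i → x₀ i ∷ X i)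
    first : ∀ u → P zero ∙ u ≡ g * y ∙ u
    first u = begin
      P zero ∙ u            ≡⟨ ∙-comm (P zero) u ⟩
      u ∙ P zero            ≡⟨ ∙-congˡ u a≡gy ⟩
      u ∙ (λ j → g * y j)   ≡⟨ ∙-scaleʳ g u y ⟩
      g * u ∙ y             ≡⟨ cong (g *_) (∙-comm u y) ⟩
      g * y ∙ u             ∎
    X⁺-zero : ∀ v → (X⁺ · v) zero ≡ g * v zero
    X⁺-zero v = begin
      (X⁺ · v) zero                           ≡⟨ ∙-suc (X⁺ zero) v ⟩
      g * v zero + (λ _ → 0ℤ) ∙ tail v        ≡⟨ cong (_+_ (g * v zero)) (∙-zeroˡ (tail v)) ⟩
      g * v zero + 0ℤ                         ≡⟨ ℤ.+-identityʳ (g * v zero) ⟩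
      g * v zero                              ∎
    X⁺-suc : ∀ v i → (X⁺ · v) (suc i) ≡ x₀ i * v zero + (X · tail v) i
    X⁺-suc v i = ∙-suc (X⁺ (suc i)) v
    factors⁺ : ∀ u → P · u ≗ X⁺ · ((y ∷ Y) · u)
    factors⁺ u zero    = trans (first u) (sym (X⁺-zero ((y ∷ Y) · u)))
    factors⁺ u (suc i) = begin
      (tail P · u) i                     ≡⟨ isolate ((tail P · u) i) (x₀ i) (y ∙ u) ⟩
      x₀ i * y ∙ u + (1ℤ * (tail P · u) i + - x₀ i * y ∙ u)
                                         ≡⟨ cong (_+_ (x₀ i * y ∙ u)) (P′-spec u i) ⟨
      x₀ i * y ∙ u + (P′ · u) i          ≡⟨ cong (_+_ (x₀ i * y ∙ u)) (factors u i) ⟩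
      x₀ i * y ∙ u + (X · Y · u) i       ≡⟨ X⁺-suc ((y ∷ Y) · u) i ⟨
      (X⁺ · ((y ∷ Y) · u)) (suc i)       ∎
      where
      isolate : ∀ p x y → p ≡ x * y + (1ℤ * p + - x * y)
      isolate = solve-∀
    injective⁺ : ∀ v → (∀ i → (X⁺ · v) i ≡ 0ℤ) → ∀ i → v i ≡ 0ℤ
    injective⁺ v Xv≡0 = λ { zero → v₀≡0 ; (suc i) → injective (tail v) rest i }
      where
      v₀≡0 : v zero ≡ 0ℤ
      v₀≡0 = ℤ.*-cancelˡ-≡ g (v zero) 0ℤ (begin
        g * v zero     ≡⟨ X⁺-zero v ⟨
        (X⁺ · v) zero  ≡⟨ Xv≡0 zero ⟩
        0ℤ             ≡⟨ ℤ.*-zeroʳ g ⟨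
        g * 0ℤ         ∎)
      rest : ∀ i → (X · tail v) i ≡ 0ℤ
      rest i = begin
        (X · tail v) i                   ≡⟨ pad (x₀ i) ((X · tail v) i) ⟩
        x₀ i * 0ℤ + (X · tail v) i       ≡⟨ cong (λ c → x₀ i * c + (X · tail v) i) v₀≡0 ⟨
        x₀ i * v zero + (X · tail v) i   ≡⟨ X⁺-suc v i ⟨
        (X⁺ · v) (suc i)                 ≡⟨ Xv≡0 (suc i) ⟩
        0ℤ                               ∎
        where
        pad : ∀ x y → y ≡ x * 0ℤ + y
        pad = solve-∀
    y∙z≡1 : y ∙ z ≡ 1ℤ
    y∙z≡1 = ℤ.*-cancelˡ-≡ g (y ∙ z) 1ℤ (begin
      g * y ∙ z   ≡⟨ first z ⟨
      P zero ∙ z  ≡⟨ a∙z≡g ⟩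
      g           ≡⟨ ℤ.*-identityʳ g ⟨
      g * 1ℤ      ∎)
    -- P′ z = x₀ - x₀ = 0 because `y ∙ z` is 1, and X is injective. Hence adding a multiple of z
    -- adjusts the first coordinate alone, which is how `surjective⁺` repairs z′.
    Yz≡0 : ∀ i → (Y · z) i ≡ 0ℤ
    Yz≡0 = injective (Y · z) λ i → begin
      (X · Y · z) i               ≡⟨ factors z i ⟨
      (P′ · z) i                  ≡⟨ P′-spec z i ⟩
      1ℤ * x₀ i + - x₀ i * y ∙ z  ≡⟨ cong (λ c → 1ℤ * x₀ i + - x₀ i * c) y∙z≡1 ⟩
      1ℤ * x₀ i + - x₀ i * 1ℤ     ≡⟨ cancel (x₀ i) ⟩
      0ℤ                          ∎
      where
      cancel : ∀ x → 1ℤ * x + - x * 1ℤ ≡ 0ℤ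
      cancel = solve-∀
    surjective⁺ : ∀ w → Σ[ v ∈ Vector ℤ m ] (y ∷ Y) · v ≗ w
    surjective⁺ w with z′ , Yz′≗w ← surjective (tail w) = v , λ { zero → first-row ; (suc i) → other-rows i }
      where
      c = w zero - y ∙ z′
      v : Vector ℤ m
      v j = 1ℤ * z′ j + c * z j
      first-row : y ∙ v ≡ w zero
      first-row = begin
        y ∙ v                     ≡⟨ ∙-linearʳ 1ℤ c y z′ z ⟩
        1ℤ * y ∙ z′ + c * y ∙ z   ≡⟨ cong (λ x → 1ℤ * y ∙ z′ + c * x) y∙z≡1 ⟩
        1ℤ * y ∙ z′ + c * 1ℤ      ≡⟨ cancel (y ∙ z′) (w zero) ⟩
        w zero                    ∎
        where
        cancel : ∀ x w → 1ℤ * x + (w - x) * 1ℤ ≡ w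
        cancel = solve-∀
      other-rows : ∀ i → Y i ∙ v ≡ w (suc i)
      other-rows i = begin
        Y i ∙ v                      ≡⟨ ∙-linearʳ 1ℤ c (Y i) z′ z ⟩
        1ℤ * Y i ∙ z′ + c * Y i ∙ z  ≡⟨ cong₂ (λ x x′ → 1ℤ * x + c * x′) (Yz′≗w i) (Yz≡0 i) ⟩
        1ℤ * w (suc i) + c * 0ℤ      ≡⟨ cancel (w (suc i)) c ⟩
        w (suc i)                    ∎
        where
        cancel : ∀ w c → 1ℤ * w + c * 0ℤ ≡ w
        cancel = solve-∀

  -- Conference graphs and their eigenlattices

  record ConferenceGraph {n} (A : Matrix n n) (r : ℕ) : Set where
    field
      order     : n ≡ 1 ℕ.+ 4 ℕ.* r
      diagonal  : ∀ i → A i i ≡ 0ℤ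
      -- Row and column sums are separate fields, as symmetry of A is not among the fields.
      rowSum    : ∀ i → A i ∙ 𝟙 ≡ + 2 * + r
      columnSum : ∀ k → 𝟙 ∙ (λ j → A j k) ≡ + 2 * + r
      -- The graph is strongly regular with parameters (4r+1, 2r, r-1, r); the entry is spelled as a
      -- nested linear combination for `∙-linearˡ`.
      square    : ∀ i k → A i ∙ (λ j → A j k) ≡ 1ℤ * (+ r * δ i k + + r * 1ℤ) + - 1ℤ * A i k

    order-ℤ : + n ≡ 1ℤ + + 4 * + r
    order-ℤ = begin
      + n                     ≡⟨ cong +_ order ⟩
      1ℤ + + (4 ℕ.* r)        ≡⟨ cong (_+_ 1ℤ) (ℤ.pos-* 4 r) ⟩
      1ℤ + + 4 * + r          ∎

    instance
      order-nonZero : ℤ.NonZero (+ n)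
      order-nonZero = subst (λ m → ℤ.NonZero (+ m)) (sym order) _

    A·A· : ∀ u i → (A · A · u) i ≡ 1ℤ * (+ r * u i + + r * 𝟙 ∙ u) + - 1ℤ * (A · u) i
    A·A· u i = begin
      (A · A · u) i
        ≡⟨ ·-assoc A A u i ⟩
      (λ k → A i ∙ (λ j → A j k)) ∙ u
        ≡⟨ ∙-congʳ u (square i) ⟩
      (λ k → 1ℤ * (+ r * δ i k + + r * 1ℤ) + - 1ℤ * A i k) ∙ u
        ≡⟨ ∙-linearˡ 1ℤ (- 1ℤ) (λ k → + r * δ i k + + r * 1ℤ) (A i) u ⟩
      1ℤ * (λ k → + r * δ i k + + r * 1ℤ) ∙ u + - 1ℤ * A i ∙ u
        ≡⟨ cong (λ z → 1ℤ * z + - 1ℤ * A i ∙ u) (∙-linearˡ (+ r) (+ r) (δ i) 𝟙 u) ⟩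
      1ℤ * (+ r * δ i ∙ u + + r * 𝟙 ∙ u) + - 1ℤ * A i ∙ u
        ≡⟨ cong (λ z → 1ℤ * (+ r * z + + r * 𝟙 ∙ u) + - 1ℤ * A i ∙ u) (∙-basisˡ i u) ⟩
      1ℤ * (+ r * u i + + r * 𝟙 ∙ u) + - 1ℤ * (A · u) i
        ∎

    𝟙∙A· : ∀ u → 𝟙 ∙ (A · u) ≡ + 2 * + r * 𝟙 ∙ u
    𝟙∙A· u = begin
      -- The row vector `𝟙` is treated as a matrix with one row, so that associativity moves A to
      -- the left factor.
      𝟙 ∙ (A · u)                       ≡⟨ ·-assoc {1} (λ _ → 𝟙) A u zero ⟩
      (λ k → 𝟙 ∙ (λ j → A j k)) ∙ u     ≡⟨ ∙-congʳ u (λ k → trans (columnSum k) (sym (ℤ.*-identityʳ (+ 2 * + r)))) ⟩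
      (λ k → + 2 * + r * 𝟙 k) ∙ u       ≡⟨ ∙-comm _ u ⟩
      u ∙ (λ k → + 2 * + r * 𝟙 k)       ≡⟨ ∙-scaleʳ (+ 2 * + r) u 𝟙 ⟩
      + 2 * + r * u ∙ 𝟙                 ≡⟨ cong (+ 2 * + r *_) (∙-comm u 𝟙) ⟩
      + 2 * + r * 𝟙 ∙ u                 ∎

  -- For an eigenvalue τ, so that r = τ(τ+1), the other one is −1−τ and their
  -- difference is s = −1−2τ with s² = n. On sums-to-zero vectors the operator
  -- P = s(A − τ) + τJ is n times the projection onto the (−1−τ)-eigenspace.
  module Eigenprojection {n} {A : Matrix n n} {r} (G : ConferenceGraph A r)
                         (τ : ℤ) (r≡τ[τ+1] : + r ≡ τ * (τ + 1ℤ)) where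
    open ConferenceGraph G

    s : ℤ
    s = - 1ℤ - + 2 * τ

    P : Matrix n n
    P i j = s * A i j + 1ℤ * (- (s * τ) * δ i j + τ * 1ℤ)

    P·-spec : ∀ u i → (P · u) i ≡ s * (A · u) i + 1ℤ * (- (s * τ) * u i + τ * 𝟙 ∙ u)
    P·-spec u i = begin
      (P · u) i
        ≡⟨ ∙-linearˡ s 1ℤ (A i) (λ j → - (s * τ) * δ i j + τ * 1ℤ) u ⟩
      s * (A · u) i + 1ℤ * (λ j → - (s * τ) * δ i j + τ * 1ℤ) ∙ u
        ≡⟨ cong (λ z → s * (A · u) i + 1ℤ * z) (∙-linearˡ (- (s * τ)) τ (δ i) 𝟙 u) ⟩
      s * (A · u) i + 1ℤ * (- (s * τ) * δ i ∙ u + τ * 𝟙 ∙ u)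
        ≡⟨ cong (λ z → s * (A · u) i + 1ℤ * (- (s * τ) * z + τ * 𝟙 ∙ u)) (∙-basisˡ i u) ⟩
      s * (A · u) i + 1ℤ * (- (s * τ) * u i + τ * 𝟙 ∙ u)
        ∎

    -- The left vector is arbitrary because both a row of A and `𝟙` are inserted for it later.
    ∙P· : ∀ w u → w ∙ (P · u) ≡ s * w ∙ (A · u) + 1ℤ * (- (s * τ) * w ∙ u + τ * 𝟙 ∙ u * w ∙ 𝟙)
    ∙P· w u = begin
      w ∙ (P · u)
        ≡⟨ ∙-congˡ w (λ i → trans (P·-spec u i) (unit s τ ((A · u) i) (u i) (𝟙 ∙ u))) ⟩
      w ∙ (λ i → s * (A · u) i + 1ℤ * (- (s * τ) * u i + τ * 𝟙 ∙ u * 𝟙 i))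
        ≡⟨ ∙-linearʳ s 1ℤ w (A · u) (λ i → - (s * τ) * u i + τ * 𝟙 ∙ u * 𝟙 i) ⟩
      s * w ∙ (A · u) + 1ℤ * w ∙ (λ i → - (s * τ) * u i + τ * 𝟙 ∙ u * 𝟙 i)
        ≡⟨ cong (λ z → s * w ∙ (A · u) + 1ℤ * z) (∙-linearʳ (- (s * τ)) (τ * 𝟙 ∙ u) w u 𝟙) ⟩
      s * w ∙ (A · u) + 1ℤ * (- (s * τ) * w ∙ u + τ * 𝟙 ∙ u * w ∙ 𝟙)
        ∎
      where
      unit : ∀ s τ a x S → s * a + 1ℤ * (- (s * τ) * x + τ * S) ≡ s * a + 1ℤ * (- (s * τ) * x + τ * S * 1ℤ)
      unit = solve-∀

    -- By r = τ(τ+1) the relation for A² becomes (A - τ)(A + 1 + τ) = rJ. Thus (A + 1 + τ)P is a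
    -- multiple of J, with coefficient τ(τ+1)(s + 2τ + 1) = 0.
    A·P· : ∀ u i → (A · P · u) i ≡ (- 1ℤ - τ) * (P · u) i
    A·P· u i = begin
      A i ∙ (P · u)
        ≡⟨ ∙P· (A i) u ⟩
      s * (A · A · u) i + 1ℤ * (- (s * τ) * (A · u) i + τ * 𝟙 ∙ u * A i ∙ 𝟙)
        ≡⟨ cong₂ (λ y z → s * y + 1ℤ * (- (s * τ) * (A · u) i + τ * 𝟙 ∙ u * z)) (A·A· u i) (rowSum i) ⟩
      s * (1ℤ * (+ r * u i + + r * 𝟙 ∙ u) + - 1ℤ * (A · u) i) + 1ℤ * (- (s * τ) * (A · u) i + τ * 𝟙 ∙ u * (+ 2 * + r))
        ≡⟨ identity (+ r) r≡τ[τ+1] ((A · u) i) (u i) (𝟙 ∙ u) ⟩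
      (- 1ℤ - τ) * (s * (A · u) i + 1ℤ * (- (s * τ) * u i + τ * 𝟙 ∙ u))
        ≡⟨ cong ((- 1ℤ - τ) *_) (P·-spec u i) ⟨
      (- 1ℤ - τ) * (P · u) i
        ∎
      where
      polynomial : ∀ τ a x S → let s = - 1ℤ - + 2 * τ ; ρ = τ * (τ + 1ℤ) in
        s * (1ℤ * (ρ * x + ρ * S) + - 1ℤ * a) + 1ℤ * (- (s * τ) * a + τ * S * (+ 2 * ρ))
        ≡ (- 1ℤ - τ) * (s * a + 1ℤ * (- (s * τ) * x + τ * S))
      polynomial = solve-∀
      -- `+ r` is no variable, so its equation cannot be matched with `refl`; generalized to ρ it
      -- becomes a polynomial in τ for the solver.
      identity : ∀ ρ → ρ ≡ τ * (τ + 1ℤ) → ∀ a x S →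
        s * (1ℤ * (ρ * x + ρ * S) + - 1ℤ * a) + 1ℤ * (- (s * τ) * a + τ * S * (+ 2 * ρ))
        ≡ (- 1ℤ - τ) * (s * a + 1ℤ * (- (s * τ) * x + τ * S))
      identity _ refl = polynomial τ

    -- The summand τJ is chosen for this: the column sums s(2r - τ) + τn vanish.
    𝟙∙P· : ∀ u → 𝟙 ∙ (P · u) ≡ 0ℤ
    𝟙∙P· u = begin
      𝟙 ∙ (P · u)
        ≡⟨ ∙P· 𝟙 u ⟩
      s * 𝟙 ∙ (A · u) + 1ℤ * (- (s * τ) * 𝟙 ∙ u + τ * 𝟙 ∙ u * 𝟙 {n} ∙ 𝟙)
        ≡⟨ cong₂ (λ y z → s * y + 1ℤ * (- (s * τ) * 𝟙 ∙ u + τ * 𝟙 ∙ u * z)) (𝟙∙A· u) (trans (𝟙∙𝟙≡n n) order-ℤ) ⟩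
      s * (+ 2 * + r * 𝟙 ∙ u) + 1ℤ * (- (s * τ) * 𝟙 ∙ u + τ * 𝟙 ∙ u * (1ℤ + + 4 * + r))
        ≡⟨ identity (+ r) r≡τ[τ+1] (𝟙 ∙ u) ⟩
      0ℤ
        ∎
      where
      polynomial : ∀ τ S → let s = - 1ℤ - + 2 * τ ; ρ = τ * (τ + 1ℤ) in
        s * (+ 2 * ρ * S) + 1ℤ * (- (s * τ) * S + τ * S * (1ℤ + + 4 * ρ)) ≡ 0ℤ
      polynomial = solve-∀
      identity : ∀ ρ → ρ ≡ τ * (τ + 1ℤ) → ∀ S →
        s * (+ 2 * ρ * S) + 1ℤ * (- (s * τ) * S + τ * S * (1ℤ + + 4 * ρ)) ≡ 0ℤ
      identity _ refl = polynomial τ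

    s*s≡n : s * s ≡ + n
    s*s≡n = begin
      s * s                         ≡⟨ polynomial τ ⟩
      1ℤ + + 4 * (τ * (τ + 1ℤ))     ≡⟨ cong (λ z → 1ℤ + + 4 * z) r≡τ[τ+1] ⟨
      1ℤ + + 4 * + r                ≡⟨ order-ℤ ⟨
      + n                           ∎
      where
      polynomial : ∀ τ → (- 1ℤ - + 2 * τ) * (- 1ℤ - + 2 * τ) ≡ 1ℤ + + 4 * (τ * (τ + 1ℤ))
      polynomial = solve-∀

    -- On the image of P the coordinate sum is 0 and A acts as -1-τ, so P acts there as s(-1-2τ) =
    -- s².
    P·P· : ∀ u i → (P · P · u) i ≡ + n * (P · u) i
    P·P· u i = begin
      (P · P · u) i
        ≡⟨ P·-spec (P · u) i ⟩
      s * (A · P · u) i + 1ℤ * (- (s * τ) * (P · u) i + τ * 𝟙 ∙ (P · u))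
        ≡⟨ cong₂ (λ y z → s * y + 1ℤ * (- (s * τ) * (P · u) i + τ * z)) (A·P· u i) (𝟙∙P· u) ⟩
      s * ((- 1ℤ - τ) * (P · u) i) + 1ℤ * (- (s * τ) * (P · u) i + τ * 0ℤ)
        ≡⟨ polynomial τ ((P · u) i) ⟩
      s * s * (P · u) i
        ≡⟨ cong (_* (P · u) i) s*s≡n ⟩
      + n * (P · u) i
        ∎
      where
      polynomial : ∀ τ x → let s = - 1ℤ - + 2 * τ in
        s * ((- 1ℤ - τ) * x) + 1ℤ * (- (s * τ) * x + τ * 0ℤ) ≡ s * s * x
      polynomial = solve-∀

    -- P commutes with A: the only term in doubt is τJ, and JA = AJ because row and column sums
    -- agree.
    P·A· : ∀ u i → (P · A · u) i ≡ (- 1ℤ - τ) * (P · u) i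
    P·A· u i = begin
      (P · A · u) i
        ≡⟨ P·-spec (A · u) i ⟩
      s * (A · A · u) i + 1ℤ * (- (s * τ) * (A · u) i + τ * 𝟙 ∙ (A · u))
        ≡⟨ cong (λ z → s * (A · A · u) i + 1ℤ * (- (s * τ) * (A · u) i + z)) (begin
             τ * 𝟙 ∙ (A · u)              ≡⟨ cong (τ *_) (𝟙∙A· u) ⟩
             τ * (+ 2 * + r * 𝟙 ∙ u)      ≡⟨ commute τ (+ 2 * + r) (𝟙 ∙ u) ⟩
             τ * 𝟙 ∙ u * (+ 2 * + r)      ≡⟨ cong (τ * 𝟙 ∙ u *_) (rowSum i) ⟨
             τ * 𝟙 ∙ u * A i ∙ 𝟙          ∎) ⟩
      s * (A · A · u) i + 1ℤ * (- (s * τ) * (A · u) i + τ * 𝟙 ∙ u * A i ∙ 𝟙)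
        ≡⟨ ∙P· (A i) u ⟨
      (A · P · u) i
        ≡⟨ A·P· u i ⟩
      (- 1ℤ - τ) * (P · u) i
        ∎
      where
      commute : ∀ a b c → a * (b * c) ≡ a * c * b
      commute = solve-∀

    P·𝟙 : ∀ i → (P · 𝟙) i ≡ 0ℤ
    P·𝟙 i = begin
      (P · 𝟙) i
        ≡⟨ P·-spec 𝟙 i ⟩
      s * (A · 𝟙) i + 1ℤ * (- (s * τ) * 1ℤ + τ * 𝟙 {n} ∙ 𝟙)
        ≡⟨ cong₂ (λ y z → s * y + 1ℤ * (- (s * τ) * 1ℤ + τ * z)) (rowSum i) (trans (𝟙∙𝟙≡n n) order-ℤ) ⟩
      s * (+ 2 * + r) + 1ℤ * (- (s * τ) * 1ℤ + τ * (1ℤ + + 4 * + r))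
        ≡⟨ identity (+ r) r≡τ[τ+1] ⟩
      0ℤ ∎
      where
      polynomial : ∀ τ → let s = - 1ℤ - + 2 * τ ; ρ = τ * (τ + 1ℤ) in
        s * (+ 2 * ρ) + 1ℤ * (- (s * τ) * 1ℤ + τ * (1ℤ + + 4 * ρ)) ≡ 0ℤ
      polynomial = solve-∀
      identity : ∀ ρ → ρ ≡ τ * (τ + 1ℤ) → s * (+ 2 * ρ) + 1ℤ * (- (s * τ) * 1ℤ + τ * (1ℤ + + 4 * ρ)) ≡ 0ℤ
      identity _ refl = polynomial τ

    -- Since A has zero diagonal, every diagonal entry of P is τ(1 - s) = 2τ(τ+1) = 2r.
    trace-P : ∑[ i < n ] P i i ≡ + n * + (2 ℕ.* r)
    trace-P = begin
      ∑[ i < n ] P i i                            ≡⟨ sum-cong-≗ entry ⟩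
      ∑[ i < n ] (+ 2 * (τ * (τ + 1ℤ)))           ≡⟨ sum-const n _ ⟩
      + n * (+ 2 * (τ * (τ + 1ℤ)))                ≡⟨ cong (λ z → + n * (+ 2 * z)) r≡τ[τ+1] ⟨
      + n * (+ 2 * + r)                           ≡⟨ cong (+ n *_) (ℤ.pos-* 2 r) ⟨
      + n * + (2 ℕ.* r)                           ∎
      where
      polynomial : ∀ τ → let s = - 1ℤ - + 2 * τ in
        s * 0ℤ + 1ℤ * (- (s * τ) * 1ℤ + τ * 1ℤ) ≡ + 2 * (τ * (τ + 1ℤ))
      polynomial = solve-∀
      entry : ∀ i → P i i ≡ + 2 * (τ * (τ + 1ℤ))
      entry i = trans (cong₂ (λ y z → s * y + 1ℤ * (- (s * τ) * z + τ * 1ℤ)) (diagonal i) (δ-diag i)) (polynomial τ)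

  -- The image of P as a lattice of rank k on which A acts as the scalar θ. X embeds it and Y is n
  -- times a left inverse; both intertwine A with θ and are orthogonal to `𝟙`.
  record Eigenlattice {n} (A : Matrix n n) (k : ℕ) (P : Matrix n n) (θ : ℤ) : Set where
    field
      X   : Matrix n k
      Y   : Matrix k n
      X·Y· : ∀ u i → (X · Y · u) i ≡ (P · u) i
      Y·X· : ∀ w i → (Y · X · w) i ≡ + n * w i
      A·X· : ∀ w i → (A · X · w) i ≡ θ * (X · w) i
      Y·A· : ∀ u i → (Y · A · u) i ≡ θ * (Y · u) i
      Y·𝟙 : ∀ i → (Y · 𝟙) i ≡ 0ℤ
      𝟙∙X· : ∀ w → 𝟙 ∙ (X · w) ≡ 0ℤ

  -- Since nX = PX and nY = YP, the identities for P carry over to X and Y once n is cancelled.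
  eigenlattice : ∀ {n} {A : Matrix n n} {r} (G : ConferenceGraph A r)
                 (τ : ℤ) (r≡ : + r ≡ τ * (τ + 1ℤ)) →
                 Eigenlattice A (2 ℕ.* r) (Eigenprojection.P G τ r≡) (- 1ℤ - τ)
  eigenlattice {n} {A} {r} G τ r≡ = subst (λ k → Eigenlattice A k P (- 1ℤ - τ)) rank≡2r record
    { X = X ; Y = Y ; X·Y· = λ u i → sym (factors u i) ; Y·X· = Y·X·
    ; A·X· = λ w i → ℤ.*-cancelˡ-≡ (+ n) _ _ (begin
        + n * (A · X · w) i                 ≡⟨ ∙-scaleʳ (+ n) (A i) (X · w) ⟨
        A i ∙ (λ j → + n * (X · w) j)       ≡⟨ ∙-congˡ (A i) (nX· w) ⟩
        (A · P · X · w) i                   ≡⟨ A·P· (X · w) i ⟩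
        (- 1ℤ - τ) * (P · X · w) i          ≡⟨ cong ((- 1ℤ - τ) *_) (nX· w i) ⟨
        (- 1ℤ - τ) * (+ n * (X · w) i)      ≡⟨ swap (- 1ℤ - τ) (+ n) ((X · w) i) ⟩
        + n * ((- 1ℤ - τ) * (X · w) i)      ∎)
    ; Y·A· = λ u i → ℤ.*-cancelˡ-≡ (+ n) _ _ (begin
        + n * (Y · A · u) i                 ≡⟨ nY· (A · u) i ⟩
        (Y · P · A · u) i                   ≡⟨ ∙-congˡ (Y i) (P·A· u) ⟩
        Y i ∙ (λ j → (- 1ℤ - τ) * (P · u) j) ≡⟨ ∙-scaleʳ (- 1ℤ - τ) (Y i) (P · u) ⟩
        (- 1ℤ - τ) * (Y · P · u) i          ≡⟨ cong ((- 1ℤ - τ) *_) (nY· u i) ⟨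
        (- 1ℤ - τ) * (+ n * (Y · u) i)      ≡⟨ swap (- 1ℤ - τ) (+ n) ((Y · u) i) ⟩
        + n * ((- 1ℤ - τ) * (Y · u) i)      ∎)
    ; Y·𝟙 = λ i → ℤ.*-cancelˡ-≡ (+ n) _ _ (begin
        + n * (Y · 𝟙) i        ≡⟨ nY· 𝟙 i ⟩
        (Y · P · 𝟙) i          ≡⟨ ∙-congˡ (Y i) P·𝟙 ⟩
        Y i ∙ (λ _ → 0ℤ)       ≡⟨ ∙-zeroʳ (Y i) ⟩
        0ℤ                     ≡⟨ ℤ.*-zeroʳ (+ n) ⟨
        + n * 0ℤ               ∎)
    ; 𝟙∙X· = λ w → ℤ.*-cancelˡ-≡ (+ n) _ _ (begin
        + n * 𝟙 ∙ (X · w)              ≡⟨ ∙-scaleʳ (+ n) 𝟙 (X · w) ⟨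
        𝟙 ∙ (λ j → + n * (X · w) j)    ≡⟨ ∙-congˡ 𝟙 (nX· w) ⟩
        𝟙 ∙ (P · X · w)                ≡⟨ 𝟙∙P· (X · w) ⟩
        0ℤ                             ≡⟨ ℤ.*-zeroʳ (+ n) ⟨
        + n * 0ℤ                       ∎)
    }
    where
    open ConferenceGraph G
    open Eigenprojection G τ r≡
    open RankFactorization (rankFactorization P)

    swap : ∀ a b c → a * (b * c) ≡ b * (a * c)
    swap = solve-∀

    -- As w = Y z, the vector X w = P z lies in the image of P, where P acts as n. So X annihilates
    -- d = Y X w - n w, and X is injective.
    Y·X· : ∀ w i → (Y · X · w) i ≡ + n * w i
    Y·X· w i with z , Yz≗w ← surjective w = begin
      (Y · X · w) i                            ≡⟨ difference ((Y · X · w) i) (+ n * w i) ⟩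
      d i + + n * w i                          ≡⟨ cong (_+ + n * w i) (injective d X·d≡0 i) ⟩
      0ℤ + + n * w i                           ≡⟨ ℤ.+-identityˡ (+ n * w i) ⟩
      + n * w i                                ∎
      where
      difference : ∀ x y → x ≡ (1ℤ * x + - 1ℤ * y) + y
      difference = solve-∀
      d : Vector ℤ rank
      d i = 1ℤ * (Y · X · w) i + - 1ℤ * (+ n * w i)
      X·w≗P·z : X · w ≗ P · z
      X·w≗P·z j = trans (sym (∙-congˡ (X j) Yz≗w)) (sym (factors z j))
      X·d≡0 : ∀ j → (X · d) j ≡ 0ℤ
      X·d≡0 j = begin
        X j ∙ d
          ≡⟨ ∙-linearʳ 1ℤ (- 1ℤ) (X j) (Y · X · w) (λ i → + n * w i) ⟩
        1ℤ * (X · Y · X · w) j + - 1ℤ * X j ∙ (λ i → + n * w i)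
          ≡⟨ cong₂ (λ x y → 1ℤ * x + - 1ℤ * y) (sym (factors (X · w) j)) (∙-scaleʳ (+ n) (X j) w) ⟩
        1ℤ * (P · X · w) j + - 1ℤ * (+ n * (X · w) j)
          ≡⟨ cong₂ (λ x y → 1ℤ * x + - 1ℤ * (+ n * y)) (trans (∙-congˡ (P j) X·w≗P·z) (P·P· z j)) (X·w≗P·z j) ⟩
        1ℤ * (+ n * (P · z) j) + - 1ℤ * (+ n * (P · z) j)
          ≡⟨ cancel (+ n * (P · z) j) ⟩
        0ℤ
          ∎
        where
        cancel : ∀ x → 1ℤ * x + - 1ℤ * x ≡ 0ℤ
        cancel = solve-∀

    nX· : ∀ w i → + n * (X · w) i ≡ (P · X · w) i
    nX· w i = begin
      + n * (X · w) i            ≡⟨ ∙-scaleʳ (+ n) (X i) w ⟨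
      X i ∙ (λ l → + n * w l)    ≡⟨ ∙-congˡ (X i) (Y·X· w) ⟨
      (X · Y · X · w) i          ≡⟨ factors (X · w) i ⟨
      (P · X · w) i              ∎

    nY· : ∀ u i → + n * (Y · u) i ≡ (Y · P · u) i
    nY· u i = begin
      + n * (Y · u) i    ≡⟨ Y·X· (Y · u) i ⟨
      (Y · X · Y · u) i  ≡⟨ ∙-congˡ (Y i) (factors u) ⟨
      (Y · P · u) i      ∎

    -- The diagonal of Y X is constantly n and X Y has the diagonal of P, so cyclicity of the trace
    -- compares n · rank with `trace-P`.
    rank≡2r : rank ≡ 2 ℕ.* r
    rank≡2r = ℤ.+-injective (ℤ.*-cancelˡ-≡ (+ n) _ _ (begin
      + n * + rank                              ≡⟨ ℤ.*-comm (+ n) (+ rank) ⟩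
      + rank * + n                              ≡⟨ sum-const rank (+ n) ⟨
      ∑[ l < rank ] (+ n)                       ≡⟨ sum-cong-≗ YX-diagonal ⟨
      ∑[ l < rank ] (Y l ∙ (λ i → X i l))       ≡⟨ trace-comm X Y ⟨
      ∑[ i < n ] (X i ∙ (λ l → Y l i))          ≡⟨ sum-cong-≗ XY-diagonal ⟩
      ∑[ i < n ] P i i                          ≡⟨ trace-P ⟩
      + n * + (2 ℕ.* r)                         ∎))
      where
      YX-diagonal : ∀ l → Y l ∙ (λ i → X i l) ≡ + n
      YX-diagonal l = begin
        Y l ∙ (λ i → X i l)                 ≡⟨ ∙-congˡ (Y l) (λ i → ∙-basisʳ (X i) l) ⟨
        (Y · X · (λ j → δ j l)) l           ≡⟨ Y·X· (λ j → δ j l) l ⟩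
        + n * δ l l                         ≡⟨ cong (+ n *_) (δ-diag l) ⟩
        + n * 1ℤ                            ≡⟨ ℤ.*-identityʳ (+ n) ⟩
        + n                                 ∎
      XY-diagonal : ∀ i → X i ∙ (λ l → Y l i) ≡ P i i
      XY-diagonal i = begin
        X i ∙ (λ l → Y l i)                 ≡⟨ ∙-congˡ (X i) (λ l → ∙-basisʳ (Y l) i) ⟨
        (X · Y · (λ j → δ j i)) i           ≡⟨ factors (λ j → δ j i) i ⟨
        (P · (λ j → δ j i)) i               ≡⟨ ∙-basisʳ (P i) i ⟩
        P i i                               ∎

  -- The isomorphism from the cokernel

  module SmithGroup {n} {A : Matrix n n} {r} (G : ConferenceGraph A r)
                    (θ : ℤ) (r≡θ[θ+1] : + r ≡ θ * (θ + 1ℤ)) where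
    open ConferenceGraph G

    τ s : ℤ
    τ = - 1ℤ - θ
    s = θ - τ

    r≡τ[τ+1] : + r ≡ τ * (τ + 1ℤ)
    r≡τ[τ+1] = trans r≡θ[θ+1] (polynomial θ)
      where
      polynomial : ∀ θ → θ * (θ + 1ℤ) ≡ (- 1ℤ - θ) * (- 1ℤ - θ + 1ℤ)
      polynomial = solve-∀

    r≡-θτ : + r ≡ - (θ * τ)
    r≡-θτ = trans r≡θ[θ+1] (polynomial θ)
      where
      polynomial : ∀ θ → θ * (θ + 1ℤ) ≡ - (θ * (- 1ℤ - θ))
      polynomial = solve-∀

    -- The label is the eigenvalue that the projection kills: `Pτ` and `τ-side`, with X₁ and Y₁,
    -- belong to the θ-eigenspace, while `Pθ` and `θ-side`, with X₂ and Y₂, belong to the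
    -- τ-eigenspace.
    module Pτ = Eigenprojection G τ r≡τ[τ+1]
    module Pθ = Eigenprojection G θ r≡θ[θ+1]
    module τ-side = Eigenlattice (eigenlattice G τ r≡τ[τ+1])
    module θ-side = Eigenlattice (eigenlattice G θ r≡θ[θ+1])
    open τ-side using () renaming (X to X₁; Y to Y₁)
    open θ-side using () renaming (X to X₂; Y to Y₂)

    θ≡-1-τ : - 1ℤ - τ ≡ θ
    θ≡-1-τ = polynomial θ
      where
      polynomial : ∀ θ → - 1ℤ - (- 1ℤ - θ) ≡ θ
      polynomial = solve-∀

    A·X₁· : ∀ w i → (A · X₁ · w) i ≡ θ * (X₁ · w) i
    A·X₁· w i = trans (τ-side.A·X· w i) (cong (_* (X₁ · w) i) θ≡-1-τ)

    Y₁·A· : ∀ u i → (Y₁ · A · u) i ≡ θ * (Y₁ · u) i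
    Y₁·A· u i = trans (τ-side.Y·A· u i) (cong (_* (Y₁ · u) i) θ≡-1-τ)

    s*s≡n : s * s ≡ + n
    s*s≡n = trans (polynomial θ) Pθ.s*s≡n
      where
      polynomial : ∀ θ → (θ - (- 1ℤ - θ)) * (θ - (- 1ℤ - θ)) ≡ (- 1ℤ - + 2 * θ) * (- 1ℤ - + 2 * θ)
      polynomial = solve-∀

    -- Multiplying (θ - τ)t = 0 by s turns the factor into n, which is known to be nonzero.
    cross-zero : ∀ {t} → θ * t ≡ τ * t → t ≡ 0ℤ
    cross-zero {t} θt≡τt = ℤ.*-cancelˡ-≡ (+ n) t 0ℤ (begin
      + n * t                ≡⟨ cong (_* t) s*s≡n ⟨
      s * s * t              ≡⟨ expand s θ τ t ⟩
      s * (θ * t - τ * t)    ≡⟨ cong (λ z → s * (z - τ * t)) θt≡τt ⟩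
      s * (τ * t - τ * t)    ≡⟨ cancel s (τ * t) (+ n) ⟩
      + n * 0ℤ               ∎)
      where
      expand : ∀ s θ τ t → s * (θ - τ) * t ≡ s * (θ * t - τ * t)
      expand = solve-∀
      cancel : ∀ s x n → s * (x - x) ≡ n * 0ℤ
      cancel = solve-∀

    -- In Y₁ A X₂ the matrix A acts as θ on the left factor and as τ on the right one.
    Y₁·X₂· : ∀ w i → (Y₁ · X₂ · w) i ≡ 0ℤ
    Y₁·X₂· w i = cross-zero (begin
      θ * (Y₁ · X₂ · w) i              ≡⟨ Y₁·A· (X₂ · w) i ⟨
      (Y₁ · A · X₂ · w) i              ≡⟨ ∙-congˡ (Y₁ i) (θ-side.A·X· w) ⟩
      Y₁ i ∙ (λ j → τ * (X₂ · w) j)    ≡⟨ ∙-scaleʳ τ (Y₁ i) (X₂ · w) ⟩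
      τ * (Y₁ · X₂ · w) i              ∎)

    Y₂·X₁· : ∀ w i → (Y₂ · X₁ · w) i ≡ 0ℤ
    Y₂·X₁· w i = cross-zero (begin
      θ * (Y₂ · X₁ · w) i              ≡⟨ ∙-scaleʳ θ (Y₂ i) (X₁ · w) ⟨
      Y₂ i ∙ (λ j → θ * (X₁ · w) j)    ≡⟨ ∙-congˡ (Y₂ i) (A·X₁· w) ⟨
      (Y₂ · A · X₁ · w) i              ≡⟨ θ-side.Y·A· (X₁ · w) i ⟩
      τ * (Y₂ · X₁ · w) i              ∎)

    -- This is n = J + Pτ + Pθ, the resolution of the identity scaled by n: the two values of `s`
    -- are opposite, so A cancels, and 1 + θ + τ = 0 removes J.
    resolution : ∀ u i → + n * u i ≡ 𝟙 ∙ u + (X₁ · Y₁ · u) i + (X₂ · Y₂ · u) i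
    resolution u i = begin
      + n * u i
        ≡⟨ cong (_* u i) (sym s*s≡n) ⟩
      s * s * u i
        ≡⟨ polynomial θ ((A · u) i) (u i) (𝟙 ∙ u) ⟩
      𝟙 ∙ u + (Pτ.s * (A · u) i + 1ℤ * (- (Pτ.s * τ) * u i + τ * 𝟙 ∙ u))
            + (Pθ.s * (A · u) i + 1ℤ * (- (Pθ.s * θ) * u i + θ * 𝟙 ∙ u))
        ≡⟨ cong₂ (λ y z → 𝟙 ∙ u + y + z) (Pτ.P·-spec u i) (Pθ.P·-spec u i) ⟨
      𝟙 ∙ u + (Pτ.P · u) i + (Pθ.P · u) i
        ≡⟨ cong₂ (λ y z → 𝟙 ∙ u + y + z) (τ-side.X·Y· u i) (θ-side.X·Y· u i) ⟨
      𝟙 ∙ u + (X₁ · Y₁ · u) i + (X₂ · Y₂ · u) i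
        ∎
      where
      polynomial : ∀ θ a x S → let τ = - 1ℤ - θ ; s = θ - τ ; s₁ = - 1ℤ - + 2 * τ ; s₂ = - 1ℤ - + 2 * θ in
        s * s * x ≡ S + (s₁ * a + 1ℤ * (- (s₁ * τ) * x + τ * S)) + (s₂ * a + 1ℤ * (- (s₂ * θ) * x + θ * S))
      polynomial = solve-∀

    opaque
      -- A later entry is congruent to Y₁ u modulo θ and to -Y₂ u modulo τ, by θ + τ = -1. On the
      -- image of A the crossed coefficients produce θτ = -r in both terms.
      f : Vector ℤ n → Vector ℤ (suc (2 ℕ.* r))
      f u = 𝟙 ∙ u ∷ (λ i → θ * (Y₂ · u) i + - τ * (Y₁ · u) i)

      f-cong : ∀ {u v} → u ≗ v → f u ≗ f v
      f-cong u≗v zero    = ∙-congˡ 𝟙 u≗v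
      f-cong u≗v (suc i) = cong₂ (λ y z → θ * y + - τ * z) (∙-congˡ (Y₂ i) u≗v) (∙-congˡ (Y₁ i) u≗v)

      f-linear : ∀ a b u v k → f (λ i → a * u i + b * v i) k ≡ a * f u k + b * f v k
      f-linear a b u v zero    = ∙-linearʳ a b 𝟙 u v
      f-linear a b u v (suc i) = begin
        θ * Y₂ i ∙ (λ j → a * u j + b * v j) + - τ * Y₁ i ∙ (λ j → a * u j + b * v j)
          ≡⟨ cong₂ (λ y z → θ * y + - τ * z) (∙-linearʳ a b (Y₂ i) u v) (∙-linearʳ a b (Y₁ i) u v) ⟩
        θ * (a * (Y₂ · u) i + b * (Y₂ · v) i) + - τ * (a * (Y₁ · u) i + b * (Y₁ · v) i)
          ≡⟨ regroup θ (- τ) a b ((Y₂ · u) i) ((Y₂ · v) i) ((Y₁ · u) i) ((Y₁ · v) i) ⟩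
        a * (θ * (Y₂ · u) i + - τ * (Y₁ · u) i) + b * (θ * (Y₂ · v) i + - τ * (Y₁ · v) i)
          ∎
        where
        regroup : ∀ θ τ a b y₂ z₂ y₁ z₁ → θ * (a * y₂ + b * z₂) + τ * (a * y₁ + b * z₁) ≡ a * (θ * y₂ + τ * y₁) + b * (θ * z₂ + τ * z₁)
        regroup = solve-∀

      f-A· : ∀ w k → + targetModuli r k ℤ.∣ f (A · w) k
      f-A· w zero    = divides (𝟙 ∙ w) (begin
        𝟙 ∙ (A · w)              ≡⟨ 𝟙∙A· w ⟩
        + 2 * + r * 𝟙 ∙ w        ≡⟨ ℤ.*-comm (+ 2 * + r) (𝟙 ∙ w) ⟩
        𝟙 ∙ w * (+ 2 * + r)      ≡⟨ cong (𝟙 ∙ w *_) (ℤ.pos-* 2 r) ⟨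
        𝟙 ∙ w * + (2 ℕ.* r)      ∎)
      f-A· w (suc i) = divides ((Y₁ · w) i - (Y₂ · w) i) (begin
        θ * (Y₂ · A · w) i + - τ * (Y₁ · A · w) i
          ≡⟨ cong₂ (λ y z → θ * y + - τ * z) (θ-side.Y·A· w i) (Y₁·A· w i) ⟩
        θ * (τ * (Y₂ · w) i) + - τ * (θ * (Y₁ · w) i)
          ≡⟨ regroup θ τ ((Y₂ · w) i) ((Y₁ · w) i) ⟩
        ((Y₁ · w) i - (Y₂ · w) i) * - (θ * τ)
          ≡⟨ cong (((Y₁ · w) i - (Y₂ · w) i) *_) r≡-θτ ⟨
        ((Y₁ · w) i - (Y₂ · w) i) * + r
          ∎)
        where
        regroup : ∀ θ τ y z → θ * (τ * y) + - τ * (θ * z) ≡ (z - y) * - (θ * τ)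
        regroup = solve-∀

    -- Twice A² + A = r(I + J) gives 2ru plus 2r(𝟙∙u)𝟙, and the surplus is A applied to (𝟙∙u)𝟙. So
    -- 2r annihilates the cokernel.
    2r-in-image : ∀ u i → A i ∙ (λ j → + 2 * (1ℤ * (A · u) j + 1ℤ * u j) + - (𝟙 ∙ u) * 1ℤ) ≡ + 2 * + r * u i
    2r-in-image u i = begin
      A i ∙ (λ j → + 2 * (1ℤ * (A · u) j + 1ℤ * u j) + - (𝟙 ∙ u) * 1ℤ)
        ≡⟨ ∙-linearʳ (+ 2) (- (𝟙 ∙ u)) (A i) (λ j → 1ℤ * (A · u) j + 1ℤ * u j) 𝟙 ⟩
      + 2 * A i ∙ (λ j → 1ℤ * (A · u) j + 1ℤ * u j) + - (𝟙 ∙ u) * A i ∙ 𝟙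
        ≡⟨ cong₂ (λ y z → + 2 * y + - (𝟙 ∙ u) * z) (∙-linearʳ 1ℤ 1ℤ (A i) (A · u) u) (rowSum i) ⟩
      + 2 * (1ℤ * (A · A · u) i + 1ℤ * (A · u) i) + - (𝟙 ∙ u) * (+ 2 * + r)
        ≡⟨ cong (λ y → + 2 * (1ℤ * y + 1ℤ * (A · u) i) + - (𝟙 ∙ u) * (+ 2 * + r)) (A·A· u i) ⟩
      + 2 * (1ℤ * (1ℤ * (+ r * u i + + r * 𝟙 ∙ u) + - 1ℤ * (A · u) i) + 1ℤ * (A · u) i) + - (𝟙 ∙ u) * (+ 2 * + r)
        ≡⟨ polynomial (+ r) (u i) ((A · u) i) (𝟙 ∙ u) ⟩
      + 2 * + r * u i
        ∎
      where
      polynomial : ∀ r x a S → + 2 * (1ℤ * (1ℤ * (r * x + r * S) + - 1ℤ * a) + 1ℤ * a) + - S * (+ 2 * r) ≡ + 2 * r * x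
      polynomial = solve-∀

    opaque
      unfolding f

      -- Modulo the image of A, d agrees with n²d. By `resolution` nd has three components; the
      -- factor s makes each eigencomponent divisible by its eigenvalue, and a second s completes
      -- s²n = n².
      kernel : ∀ d → (∀ k → + targetModuli r k ℤ.∣ f d k) → Σ[ w ∈ Vector ℤ n ] (∀ i → d i ≡ (A · w) i)
      kernel d mod with divides a Σd≡a2r ← mod zero = w , d≡A·w
        where
        b b₁ b₂ : Vector ℤ (2 ℕ.* r)
        b i  = ℤ.quotient (mod (suc i))
        -- From (θ - τ)Y₁ = θ(Y₁ - Y₂) + (θY₂ - τY₁), whose last bracket is -bθτ, the number sY₁d is
        -- divisible by θ with quotient b₁; likewise sY₂d by τ with quotient b₂.
        b₁ i = (Y₁ · d) i - (Y₂ · d) i - τ * b i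
        b₂ i = (Y₁ · d) i - (Y₂ · d) i - θ * b i

        f≡b : ∀ i → θ * (Y₂ · d) i + - τ * (Y₁ · d) i ≡ b i * - (θ * τ)
        f≡b i = trans (ℤ._∣_.equality (mod (suc i))) (cong (b i *_) r≡-θτ)

        sY₁≡θb₁ : ∀ i → s * (Y₁ · d) i ≡ θ * b₁ i
        sY₁≡θb₁ i = begin
          (θ - τ) * (Y₁ · d) i
            ≡⟨ split θ τ ((Y₁ · d) i) ((Y₂ · d) i) ⟩
          θ * ((Y₁ · d) i - (Y₂ · d) i) + (θ * (Y₂ · d) i + - τ * (Y₁ · d) i)
            ≡⟨ cong (_+_ (θ * ((Y₁ · d) i - (Y₂ · d) i))) (f≡b i) ⟩
          θ * ((Y₁ · d) i - (Y₂ · d) i) + b i * - (θ * τ)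
            ≡⟨ collect θ τ ((Y₁ · d) i) ((Y₂ · d) i) (b i) ⟩
          θ * b₁ i
            ∎
          where
          split : ∀ θ τ y z → (θ - τ) * y ≡ θ * (y - z) + (θ * z + - τ * y)
          split = solve-∀
          collect : ∀ θ τ y z b → θ * (y - z) + b * - (θ * τ) ≡ θ * (y - z - τ * b)
          collect = solve-∀

        sY₂≡τb₂ : ∀ i → s * (Y₂ · d) i ≡ τ * b₂ i
        sY₂≡τb₂ i = begin
          (θ - τ) * (Y₂ · d) i
            ≡⟨ split θ τ ((Y₁ · d) i) ((Y₂ · d) i) ⟩
          τ * ((Y₁ · d) i - (Y₂ · d) i) + (θ * (Y₂ · d) i + - τ * (Y₁ · d) i)
            ≡⟨ cong (_+_ (τ * ((Y₁ · d) i - (Y₂ · d) i))) (f≡b i) ⟩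
          τ * ((Y₁ · d) i - (Y₂ · d) i) + b i * - (θ * τ)
            ≡⟨ collect θ τ ((Y₁ · d) i) ((Y₂ · d) i) (b i) ⟩
          τ * b₂ i
            ∎
          where
          split : ∀ θ τ y z → (θ - τ) * z ≡ τ * (y - z) + (θ * z + - τ * y)
          split = solve-∀
          collect : ∀ θ τ y z b → τ * (y - z) + b * - (θ * τ) ≡ τ * (y - z - θ * b)
          collect = solve-∀

        X₁-part : ∀ i → s * (X₁ · Y₁ · d) i ≡ (A · X₁ · b₁) i
        X₁-part i = begin
          s * (X₁ · Y₁ · d) i               ≡⟨ ∙-scaleʳ s (X₁ i) (Y₁ · d) ⟨
          X₁ i ∙ (λ l → s * (Y₁ · d) l)     ≡⟨ ∙-congˡ (X₁ i) sY₁≡θb₁ ⟩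
          X₁ i ∙ (λ l → θ * b₁ l)           ≡⟨ ∙-scaleʳ θ (X₁ i) b₁ ⟩
          θ * (X₁ · b₁) i                   ≡⟨ A·X₁· b₁ i ⟨
          (A · X₁ · b₁) i                   ∎

        X₂-part : ∀ i → s * (X₂ · Y₂ · d) i ≡ (A · X₂ · b₂) i
        X₂-part i = begin
          s * (X₂ · Y₂ · d) i               ≡⟨ ∙-scaleʳ s (X₂ i) (Y₂ · d) ⟨
          X₂ i ∙ (λ l → s * (Y₂ · d) l)     ≡⟨ ∙-congˡ (X₂ i) sY₂≡τb₂ ⟩
          X₂ i ∙ (λ l → τ * b₂ l)           ≡⟨ ∙-scaleʳ τ (X₂ i) b₂ ⟩
          τ * (X₂ · b₂) i                   ≡⟨ θ-side.A·X· b₂ i ⟨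
          (A · X₂ · b₂) i                   ∎

        v : Vector ℤ n
        v i = s * a * 1ℤ + 1ℤ * (1ℤ * (X₁ · b₁) i + 1ℤ * (X₂ · b₂) i)

        -- The name reads s·n·d.
        snd≡A·v : ∀ i → s * (+ n * d i) ≡ (A · v) i
        snd≡A·v i = begin
          s * (+ n * d i)
            ≡⟨ cong (s *_) (resolution d i) ⟩
          s * (𝟙 ∙ d + (X₁ · Y₁ · d) i + (X₂ · Y₂ · d) i)
            ≡⟨ expand s (𝟙 ∙ d) ((X₁ · Y₁ · d) i) ((X₂ · Y₂ · d) i) ⟩
          s * 𝟙 ∙ d + (1ℤ * (s * (X₁ · Y₁ · d) i) + 1ℤ * (s * (X₂ · Y₂ · d) i))
            ≡⟨ cong₂ (λ y z → s * 𝟙 ∙ d + (1ℤ * y + 1ℤ * z)) (X₁-part i) (X₂-part i) ⟩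
          s * 𝟙 ∙ d + (1ℤ * (A · X₁ · b₁) i + 1ℤ * (A · X₂ · b₂) i)
            ≡⟨ cong (_+ (1ℤ * (A · X₁ · b₁) i + 1ℤ * (A · X₂ · b₂) i)) sΣd ⟩
          s * a * A i ∙ 𝟙 + (1ℤ * (A · X₁ · b₁) i + 1ℤ * (A · X₂ · b₂) i)
            ≡⟨ cong (_+_ (s * a * A i ∙ 𝟙)) (ℤ.*-identityˡ (1ℤ * (A · X₁ · b₁) i + 1ℤ * (A · X₂ · b₂) i)) ⟨
          s * a * A i ∙ 𝟙 + 1ℤ * (1ℤ * (A · X₁ · b₁) i + 1ℤ * (A · X₂ · b₂) i)
            ≡⟨ cong (λ z → s * a * A i ∙ 𝟙 + 1ℤ * z) (∙-linearʳ 1ℤ 1ℤ (A i) (X₁ · b₁) (X₂ · b₂)) ⟨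
          s * a * A i ∙ 𝟙 + 1ℤ * A i ∙ (λ j → 1ℤ * (X₁ · b₁) j + 1ℤ * (X₂ · b₂) j)
            ≡⟨ ∙-linearʳ (s * a) 1ℤ (A i) 𝟙 (λ j → 1ℤ * (X₁ · b₁) j + 1ℤ * (X₂ · b₂) j) ⟨
          (A · v) i
            ∎
          where
          expand : ∀ s x y z → s * (x + y + z) ≡ s * x + (1ℤ * (s * y) + 1ℤ * (s * z))
          expand = solve-∀
          sΣd : s * 𝟙 ∙ d ≡ s * a * A i ∙ 𝟙
          sΣd = begin
            s * 𝟙 ∙ d                  ≡⟨ cong (s *_) Σd≡a2r ⟩
            s * (a * + (2 ℕ.* r))      ≡⟨ ℤ.*-assoc s a (+ (2 ℕ.* r)) ⟨
            s * a * + (2 ℕ.* r)        ≡⟨ cong (s * a *_) (trans (ℤ.pos-* 2 r) (sym (rowSum i))) ⟩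
            s * a * A i ∙ 𝟙            ∎

        v′ w : Vector ℤ n
        v′ j = + 2 * (1ℤ * (A · d) j + 1ℤ * d j) + - (𝟙 ∙ d) * 1ℤ
        w j = s * v j + - (+ 4 + + 8 * + r) * v′ j

        -- n² = 1 + 2r(4 + 8r)
        d≡A·w : ∀ i → d i ≡ (A · w) i
        d≡A·w i = begin
          d i
            ≡⟨ split (+ r) (d i) ⟩
          (1ℤ + + 4 * + r) * ((1ℤ + + 4 * + r) * d i) + - (+ 4 + + 8 * + r) * (+ 2 * + r * d i)
            ≡⟨ cong (λ m → m * (m * d i) + - (+ 4 + + 8 * + r) * (+ 2 * + r * d i)) order-ℤ ⟨
          + n * (+ n * d i) + - (+ 4 + + 8 * + r) * (+ 2 * + r * d i)
            ≡⟨ cong (λ m → m * (+ n * d i) + - (+ 4 + + 8 * + r) * (+ 2 * + r * d i)) s*s≡n ⟨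
          s * s * (+ n * d i) + - (+ 4 + + 8 * + r) * (+ 2 * + r * d i)
            ≡⟨ cong (_+ - (+ 4 + + 8 * + r) * (+ 2 * + r * d i)) (ℤ.*-assoc s s (+ n * d i)) ⟩
          s * (s * (+ n * d i)) + - (+ 4 + + 8 * + r) * (+ 2 * + r * d i)
            ≡⟨ cong₂ (λ y z → s * y + - (+ 4 + + 8 * + r) * z) (snd≡A·v i) (sym (2r-in-image d i)) ⟩
          s * (A · v) i + - (+ 4 + + 8 * + r) * (A · v′) i
            ≡⟨ ∙-linearʳ s (- (+ 4 + + 8 * + r)) (A i) v v′ ⟨
          (A · w) i
            ∎
          where
          split : ∀ r x → x ≡ (1ℤ + + 4 * r) * ((1ℤ + + 4 * r) * x) + - (+ 4 + + 8 * r) * (+ 2 * r * x)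
          split = solve-∀

    -- The same coordinates b enter both eigenlattices, so Y₁ and Y₂ both return snb, and θY₂ - τY₁
    -- becomes (θ - τ)snb = n²b, congruent to b modulo r.
    preimage : Vector ℤ (suc (2 ℕ.* r)) → Vector ℤ n
    preimage y i = y zero * 1ℤ + s * (1ℤ * (X₁ · tail y) i + 1ℤ * (X₂ · tail y) i)

    ∙preimage : ∀ w y → w ∙ preimage y ≡ y zero * w ∙ 𝟙 + s * (1ℤ * w ∙ (X₁ · tail y) + 1ℤ * w ∙ (X₂ · tail y))
    ∙preimage w y = trans
      (∙-linearʳ (y zero) s w 𝟙 (λ i → 1ℤ * (X₁ · tail y) i + 1ℤ * (X₂ · tail y) i))
      (cong (λ z → y zero * w ∙ 𝟙 + s * z) (∙-linearʳ 1ℤ 1ℤ w (X₁ · tail y) (X₂ · tail y)))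

    opaque
      unfolding f

      f-preimage : ∀ y k → + targetModuli r k ℤ.∣ f (preimage y) k - y k
      f-preimage y zero = divides (+ 2 * y zero) (begin
        𝟙 ∙ preimage y - y zero
          ≡⟨ cong (_- y zero) (∙preimage 𝟙 y) ⟩
        y zero * 𝟙 {n} ∙ 𝟙 + s * (1ℤ * 𝟙 ∙ (X₁ · tail y) + 1ℤ * 𝟙 ∙ (X₂ · tail y)) - y zero
          ≡⟨ cong₂ (λ z z′ → y zero * 𝟙 {n} ∙ 𝟙 + s * (1ℤ * z + 1ℤ * z′) - y zero) (τ-side.𝟙∙X· (tail y)) (θ-side.𝟙∙X· (tail y)) ⟩
        y zero * 𝟙 {n} ∙ 𝟙 + s * (1ℤ * 0ℤ + 1ℤ * 0ℤ) - y zero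
          ≡⟨ cong (λ m → y zero * m + s * (1ℤ * 0ℤ + 1ℤ * 0ℤ) - y zero) (trans (𝟙∙𝟙≡n n) order-ℤ) ⟩
        y zero * (1ℤ + + 4 * + r) + s * (1ℤ * 0ℤ + 1ℤ * 0ℤ) - y zero
          ≡⟨ polynomial (+ r) s (y zero) ⟩
        + 2 * y zero * (+ 2 * + r)
          ≡⟨ cong (+ 2 * y zero *_) (ℤ.pos-* 2 r) ⟨
        + 2 * y zero * + (2 ℕ.* r)
          ∎)
        where
        polynomial : ∀ r s y → y * (1ℤ + + 4 * r) + s * (1ℤ * 0ℤ + 1ℤ * 0ℤ) - y ≡ + 2 * y * (+ 2 * r)
        polynomial = solve-∀
      -- The constant is (n² - 1)/r for n = 1 + 4r.
      f-preimage y (suc i) = divides ((+ 8 + + 16 * + r) * b) (begin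
        θ * Y₂ i ∙ preimage y + - τ * Y₁ i ∙ preimage y - b
          ≡⟨ cong₂ (λ z z′ → θ * z + - τ * z′ - b) Y₂-part Y₁-part ⟩
        θ * (s * (+ n * b)) + - τ * (s * (+ n * b)) - b
          ≡⟨ regroup θ τ (+ n) b ⟩
        s * s * (+ n * b) - b
          ≡⟨ cong (λ m → m * (+ n * b) - b) s*s≡n ⟩
        + n * (+ n * b) - b
          ≡⟨ cong (λ m → m * (m * b) - b) order-ℤ ⟩
        (1ℤ + + 4 * + r) * ((1ℤ + + 4 * + r) * b) - b
          ≡⟨ polynomial (+ r) b ⟩
        (+ 8 + + 16 * + r) * b * + r
          ∎)
        where
        b : ℤ
        b = y (suc i)
        regroup : ∀ θ τ n b → θ * ((θ - τ) * (n * b)) + - τ * ((θ - τ) * (n * b)) - b ≡ (θ - τ) * (θ - τ) * (n * b) - b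
        regroup = solve-∀
        polynomial : ∀ r b → (1ℤ + + 4 * r) * ((1ℤ + + 4 * r) * b) - b ≡ (+ 8 + + 16 * r) * b * r
        polynomial = solve-∀
        drop₁ : ∀ y s x → y * 0ℤ + s * (1ℤ * x + 1ℤ * 0ℤ) ≡ s * x
        drop₁ = solve-∀
        drop₂ : ∀ y s x → y * 0ℤ + s * (1ℤ * 0ℤ + 1ℤ * x) ≡ s * x
        drop₂ = solve-∀
        Y₁-part : Y₁ i ∙ preimage y ≡ s * (+ n * b)
        Y₁-part = begin
          Y₁ i ∙ preimage y
            ≡⟨ ∙preimage (Y₁ i) y ⟩
          y zero * Y₁ i ∙ 𝟙 + s * (1ℤ * (Y₁ · X₁ · tail y) i + 1ℤ * (Y₁ · X₂ · tail y) i)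
            ≡⟨ cong₂ (λ z z′ → y zero * z + s * (1ℤ * (Y₁ · X₁ · tail y) i + 1ℤ * z′)) (τ-side.Y·𝟙 i) (Y₁·X₂· (tail y) i) ⟩
          y zero * 0ℤ + s * (1ℤ * (Y₁ · X₁ · tail y) i + 1ℤ * 0ℤ)
            ≡⟨ drop₁ (y zero) s ((Y₁ · X₁ · tail y) i) ⟩
          s * (Y₁ · X₁ · tail y) i
            ≡⟨ cong (s *_) (τ-side.Y·X· (tail y) i) ⟩
          s * (+ n * b)
            ∎
        Y₂-part : Y₂ i ∙ preimage y ≡ s * (+ n * b)
        Y₂-part = begin
          Y₂ i ∙ preimage y
            ≡⟨ ∙preimage (Y₂ i) y ⟩
          y zero * Y₂ i ∙ 𝟙 + s * (1ℤ * (Y₂ · X₁ · tail y) i + 1ℤ * (Y₂ · X₂ · tail y) i)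
            ≡⟨ cong₂ (λ z z′ → y zero * z + s * (1ℤ * z′ + 1ℤ * (Y₂ · X₂ · tail y) i)) (θ-side.Y·𝟙 i) (Y₂·X₁· (tail y) i) ⟩
          y zero * 0ℤ + s * (1ℤ * 0ℤ + 1ℤ * (Y₂ · X₂ · tail y) i)
            ≡⟨ drop₂ (y zero) s ((Y₂ · X₂ · tail y) i) ⟩
          s * (Y₂ · X₂ · tail y) i
            ≡⟨ cong (s *_) (θ-side.Y·X· (tail y) i) ⟩
          s * (+ n * b)
            ∎

    ·≡sumℤ : ∀ w i → (A · w) i ≡ sumℤ (λ j → A i j * w j)
    ·≡sumℤ w i = trans (∙-sum (A i) w) (sym (sumℤ≡sum (λ j → A i j * w j)))

    f-difference : ∀ u v k → f u k - f v k ≡ f (λ i → u i - v i) k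
    f-difference u v k = begin
      f u k - f v k                          ≡⟨ unit (f u k) (f v k) ⟩
      1ℤ * f u k + - 1ℤ * f v k              ≡⟨ f-linear 1ℤ (- 1ℤ) u v k ⟨
      f (λ i → 1ℤ * u i + - 1ℤ * v i) k      ≡⟨ f-cong (λ i → unit (u i) (v i)) k ⟨
      f (λ i → u i - v i) k                  ∎
      where
      unit : ∀ x y → x - y ≡ 1ℤ * x + - 1ℤ * y
      unit = solve-∀

    open GroupMorphisms (Coker n A) (Target r)

    ≡⇒≈ : ∀ k (x y : ℤ) → x ≡ y → ℤ.∣ + targetModuli r k ∣ ℕ.∣ ℤ.∣ x - y ∣
    ≡⇒≈ k x _ refl = ∣⇒∣ᵤ {+ targetModuli r k} {x - x} (divides 0ℤ (ℤ.+-inverseʳ x))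

    f-isGroupIsomorphism : IsGroupIsomorphism f
    f-isGroupIsomorphism = record
      { isGroupMonomorphism = record
        { isGroupHomomorphism = record
          { isMonoidHomomorphism = record
            { isMagmaHomomorphism = record
              { isRelHomomorphism = record
                { cong = λ { {u} {v} (w , u-v≡) k → ∣⇒∣ᵤ {+ targetModuli r k} {f u k - f v k} (respects u v w u-v≡ k) } }
              ; homo = λ u v k → ≡⇒≈ k (f (λ i → u i + v i) k) (f u k + f v k) (f-homo u v k)
              }
            ; ε-homo = λ k → ≡⇒≈ k (f (λ _ → 0ℤ) k) 0ℤ (f-zero k)
            }
          ; ⁻¹-homo = λ u k → ≡⇒≈ k (f (λ i → - u i) k) (- f u k) (f-neg u k)
          }
        ; injective = λ {u} {v} fu≈fv → reflects u v (λ k → ∣ᵤ⇒∣ {+ targetModuli r k} {f u k - f v k} (fu≈fv k))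
        }
      -- Surjectivity concerns every u equivalent to the chosen preimage, hence the telescoping
      -- through f of that preimage.
      ; surjective = λ y → preimage y , λ { {u} (w , u-x≡) k → ∣⇒∣ᵤ {+ targetModuli r k} {f u k - y k}
          (subst (ℤ._∣_ (+ targetModuli r k)) (telescope (f u k) (f (preimage y) k) (y k))
            (ℤ.∣m∣n⇒∣m+n (respects u (preimage y) w u-x≡ k) (f-preimage y k))) }
      }
      where
      telescope : ∀ x y z → x - y + (y - z) ≡ x - z
      telescope = solve-∀
      respects : ∀ u v w → (∀ i → u i - v i ≡ sumℤ (λ j → A i j * w j)) →
                 ∀ k → + targetModuli r k ℤ.∣ f u k - f v k
      respects u v w u-v≡ k = subst (ℤ._∣_ (+ targetModuli r k)) (begin
        f (A · w) k                 ≡⟨ f-cong (λ i → trans (u-v≡ i) (sym (·≡sumℤ w i))) k ⟨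
        f (λ i → u i - v i) k       ≡⟨ f-difference u v k ⟨
        f u k - f v k               ∎) (f-A· w k)
      reflects : ∀ u v → (∀ k → + targetModuli r k ℤ.∣ f u k - f v k) →
                 Σ[ w ∈ Vector ℤ n ] (∀ i → u i - v i ≡ sumℤ (λ j → A i j * w j))
      reflects u v fu≈fv
        with w , d≡A·w ← kernel (λ i → u i - v i) (λ k → subst (ℤ._∣_ (+ targetModuli r k)) (f-difference u v k) (fu≈fv k))
        = w , λ i → trans (d≡A·w i) (·≡sumℤ w i)
      f-homo : ∀ u v k → f (λ i → u i + v i) k ≡ f u k + f v k
      f-homo u v k = begin
        f (λ i → u i + v i) k               ≡⟨ f-cong (λ i → unit (u i) (v i)) k ⟩
        f (λ i → 1ℤ * u i + 1ℤ * v i) k     ≡⟨ f-linear 1ℤ 1ℤ u v k ⟩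
        1ℤ * f u k + 1ℤ * f v k             ≡⟨ unit (f u k) (f v k) ⟨
        f u k + f v k                       ∎
        where
        unit : ∀ x y → x + y ≡ 1ℤ * x + 1ℤ * y
        unit = solve-∀
      f-zero : ∀ k → f (λ _ → 0ℤ) k ≡ 0ℤ
      f-zero k = f-linear 0ℤ 0ℤ (λ _ → 0ℤ) (λ _ → 0ℤ) k
      f-neg : ∀ u k → f (λ i → - u i) k ≡ - f u k
      f-neg u k = begin
        f (λ i → - u i) k                   ≡⟨ f-cong (λ i → unit (u i)) k ⟩
        f (λ i → - 1ℤ * u i + 0ℤ * u i) k   ≡⟨ f-linear (- 1ℤ) 0ℤ u u k ⟩
        - 1ℤ * f u k + 0ℤ * f u k           ≡⟨ unit (f u k) ⟨
        - f u k                             ∎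
        where
        unit : ∀ x → - x ≡ - 1ℤ * x + 0ℤ * x
        unit = solve-∀

open IntegerLinearAlgebra

-- Finite fields

prime∣!⇒≤ : ∀ {p} → Prime p → ∀ k → p ℕ.∣ k ! → p ℕ.≤ k
prime∣!⇒≤ pr zero    p∣1 = contradiction (subst Prime (ℕ.∣1⇒≡1 p∣1) pr) ¬prime[1]
prime∣!⇒≤ pr (suc k) p∣k! with euclidsLemma (suc k) (k !) pr p∣k!
... | inj₁ p∣1+k = ℕ.∣⇒≤ p∣1+k
... | inj₂ p∣k!′ = ℕ.m≤n⇒m≤1+n (prime∣!⇒≤ pr k p∣k!′)

nCk*k![n∸k]!≡n! : ∀ {n k} → k ℕ.≤ n → (n C k) ℕ.* (k ! ℕ.* (n ℕ.∸ k) !) ≡ n !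
nCk*k![n∸k]!≡n! {n} {k} k≤n =
  trans (cong (ℕ._* (k ! ℕ.* (n ℕ.∸ k) !)) (nCk≡n!/k![n-k]! k≤n)) (ℕ.m/n*n≡m (k![n∸k]!∣n! k≤n))
  where instance _ = ℕ.m*n≢0 (k !) ((n ℕ.∸ k) !) {{k ℕ.!≢0}} {{(n ℕ.∸ k) ℕ.!≢0}}

-- p divides p!, which is the binomial coefficient times k!(p-k)!, but divides neither factorial,
-- their arguments being smaller than p.
prime∣C : ∀ {p k} → Prime p → 0 ℕ.< k → k ℕ.< p → p ℕ.∣ p C k
prime∣C {p@(suc p-1)} {k} pr 0<k k<p
  with euclidsLemma (p C k) (k ! ℕ.* (p ℕ.∸ k) !) pr
         (subst (p ℕ.∣_) (sym (nCk*k![n∸k]!≡n! (ℕ.<⇒≤ k<p))) (ℕ.m∣m*n (p-1 !)))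
... | inj₁ p∣C = p∣C
... | inj₂ p∣d with euclidsLemma (k !) ((p ℕ.∸ k) !) pr p∣d
...   | inj₁ p∣k!   = contradiction (prime∣!⇒≤ pr k p∣k!) (ℕ.<⇒≱ k<p)
...   | inj₂ p∣p-k! = contradiction (prime∣!⇒≤ pr (p ℕ.∸ k) p∣p-k!) (ℕ.<⇒≱ (ℕ.∸-monoʳ-< 0<k (ℕ.<⇒≤ k<p)))

module FieldProperties {q} (F : FiniteField q) where
  open FiniteField F

  commutativeRing : CommutativeRing _ _
  commutativeRing = record { isCommutativeRing = isCommutativeRing }

  module R = CommutativeRing commutativeRing
  module Exp = Algebra.Properties.Semiring.Exp R.semiring
  open Algebra.Properties.Semiring.Mult R.semiring using () renaming (_×_ to _⊗_; ×1-homo-* to ⊗1-homo-*; ×-assoc-* to ⊗-assoc-*; ×-assocˡ to ⊗-assocˡ)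
  open Algebra.Properties.Group R.+-group public
    using (//-rightDividesˡ; //-rightDividesʳ; identityʳ-unique; x≈z//y; ⁻¹-anti-homo-//; x∙y⁻¹≈ε⇒x≈y)
  open Algebra.Properties.CommutativeSemigroup R.+-commutativeSemigroup using (xy∙z≈xz∙y)
  module +Sum = Algebra.Properties.Semiring.Sum R.semiring

  from : Carrier → Fin q
  from = Inverse.from enum

  elt-from : ∀ x → elt (from x) ≡ x
  elt-from = Inverse.strictlyInverseˡ enum

  from-elt : ∀ i → from (elt i) ≡ i
  from-elt = Inverse.strictlyInverseʳ enum

  from-injective : ∀ {x y} → from x ≡ from y → x ≡ y
  from-injective = Injection.injective (↔⇒↣ (↔-sym enum))

  elt-injective : ∀ {i j} → elt i ≡ elt j → i ≡ j
  elt-injective = Injection.injective (↔⇒↣ enum)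

  _≟_ : DecidableEquality Carrier
  _≟_ = via-injection (↔⇒↣ (↔-sym enum)) Fin._≟_

  *-cancelˡ : ∀ {x y z} → x ≢ 0# → x * y ≡ x * z → y ≡ z
  *-cancelˡ {x} {y} {z} x≢0 xy≡xz with x⁻¹ , xx⁻¹≡1 ← inverse x x≢0 = begin
    y              ≡⟨ undo y ⟨
    x⁻¹ * (x * y)  ≡⟨ cong (x⁻¹ *_) xy≡xz ⟩
    x⁻¹ * (x * z)  ≡⟨ undo z ⟩
    z              ∎
    where
    undo : ∀ w → x⁻¹ * (x * w) ≡ w
    undo w = begin
      x⁻¹ * (x * w)  ≡⟨ R.*-assoc x⁻¹ x w ⟨
      x⁻¹ * x * w    ≡⟨ cong (_* w) (trans (R.*-comm x⁻¹ x) xx⁻¹≡1) ⟩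
      1# * w         ≡⟨ R.*-identityˡ w ⟩
      w              ∎

  *-nonZero : ∀ {x y} → x ≢ 0# → y ≢ 0# → x * y ≢ 0#
  *-nonZero {x} {y} x≢0 y≢0 xy≡0 = y≢0 (*-cancelˡ x≢0 (trans xy≡0 (sym (R.zeroʳ x))))

  ^-nonZero : ∀ {x} → x ≢ 0# → ∀ k → x ^ k ≢ 0#
  ^-nonZero x≢0 zero    = 0≢1 ∘ sym
  ^-nonZero x≢0 (suc k) = *-nonZero x≢0 (^-nonZero x≢0 k)

  ^≡Exp^ : ∀ x k → x ^ k ≡ x Exp.^ k
  ^≡Exp^ x zero    = refl
  ^≡Exp^ x (suc k) = cong (x *_) (^≡Exp^ x k)

  ^-homo-* : ∀ x m n → x ^ (m ℕ.+ n) ≡ x ^ m * x ^ n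
  ^-homo-* x m n = begin
    x ^ (m ℕ.+ n)            ≡⟨ ^≡Exp^ x (m ℕ.+ n) ⟩
    x Exp.^ (m ℕ.+ n)        ≡⟨ Exp.^-homo-* x m n ⟩
    x Exp.^ m * x Exp.^ n    ≡⟨ cong₂ _*_ (^≡Exp^ x m) (^≡Exp^ x n) ⟨
    x ^ m * x ^ n            ∎

  ^-assocʳ : ∀ x m n → (x ^ m) ^ n ≡ x ^ (m ℕ.* n)
  ^-assocʳ x m n = begin
    (x ^ m) ^ n              ≡⟨ cong (_^ n) (^≡Exp^ x m) ⟩
    (x Exp.^ m) ^ n          ≡⟨ ^≡Exp^ (x Exp.^ m) n ⟩
    (x Exp.^ m) Exp.^ n      ≡⟨ Exp.^-assocʳ x m n ⟩
    x Exp.^ (m ℕ.* n)        ≡⟨ ^≡Exp^ x (m ℕ.* n) ⟨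
    x ^ (m ℕ.* n)            ∎

  1^ : ∀ k → 1# ^ k ≡ 1#
  1^ zero    = refl
  1^ (suc k) = trans (R.*-identityˡ (1# ^ k)) (1^ k)

  0^ : ∀ k .{{_ : ℕ.NonZero k}} → 0# ^ k ≡ 0#
  0^ (suc k) = R.zeroˡ (0# ^ k)

  a-[a-x]≡x : ∀ a x → a - (a - x) ≡ x
  a-[a-x]≡x a x = begin
    a - (a - x)    ≡⟨ cong (_+_ (a)) (⁻¹-anti-homo-// a x) ⟩
    a + (x - a)    ≡⟨ R.+-comm a (x - a) ⟩
    x - a + a      ≡⟨ //-rightDividesˡ a x ⟩
    x              ∎

  [a-b]-[a-x]≡x-b : ∀ a b x → (a - b) - (a - x) ≡ x - b
  [a-b]-[a-x]≡x-b a b x = trans (xy∙z≈xz∙y a (- b) (- (a - x))) (cong (_- b) (a-[a-x]≡x a x))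

  reindex : (φ : Carrier ↔ Carrier) → Fin q ↔ Fin q
  reindex φ = ↔-sym enum ↔-∘ (φ ↔-∘ enum)

  -- Translation by 1 permutes the field, so it leaves the sum of all elements unchanged while
  -- adding 1 to each of the q summands.
  characteristic : q ⊗ 1# ≡ 0#
  characteristic = identityʳ-unique (+Sum.sum elt) (q ⊗ 1#) (begin
    +Sum.sum elt + q ⊗ 1#                      ≡⟨ cong (_+_ (+Sum.sum elt)) (+Sum.sum-replicate q) ⟨
    +Sum.sum elt + +Sum.sum {q} (λ _ → 1#)     ≡⟨ +Sum.∑-distrib-+ elt (λ _ → 1#) ⟨
    +Sum.sum (λ i → elt i + 1#)                ≡⟨ +Sum.sum-cong-≗ (λ i → elt-from (elt i + 1#)) ⟨
    +Sum.sum (λ i → elt (from (elt i + 1#)))   ≡⟨ +Sum.sum-permute elt (reindex shift) ⟨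
    +Sum.sum elt                               ∎)
    where
    shift : Carrier ↔ Carrier
    shift = mk↔ₛ′ (_+ 1#) (_- 1#) (//-rightDividesˡ 1#) (//-rightDividesʳ 1#)

  ⊗1-homo-^ : ∀ p e → (p ℕ.^ e) ⊗ 1# ≡ (p ⊗ 1#) ^ e
  ⊗1-homo-^ p zero    = R.+-identityʳ 1#
  ⊗1-homo-^ p (suc e) = trans (⊗1-homo-* p (p ℕ.^ e)) (cong ((p ⊗ 1#) *_) (⊗1-homo-^ p e))

  -- Additivity of the Frobenius map

  module Frobenius {p e} (prime : Prime p) (q≡p^e : q ≡ p ℕ.^ e) where
    open Algebra.Properties.CommutativeSemiring.Binomial R.commutativeSemiring
      using (binomialTerm; binomialExpansion) renaming (theorem to binomialTheorem)

    -- The power (p·1)^e equals q·1 = 0, and a field has no nonzero nilpotents.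
    p⊗1≡0 : p ⊗ 1# ≡ 0#
    p⊗1≡0 with (p ⊗ 1#) ≟ 0#
    ... | yes p1≡0 = p1≡0
    ... | no  p1≢0 = contradiction
      (trans (sym (⊗1-homo-^ p e)) (trans (cong (_⊗ 1#) (sym q≡p^e)) characteristic))
      (^-nonZero p1≢0 e)

    p⊗x≡0 : ∀ x → p ⊗ x ≡ 0#
    p⊗x≡0 x = begin
      p ⊗ x           ≡⟨ cong (p ⊗_) (R.*-identityˡ x) ⟨
      p ⊗ (1# * x)    ≡⟨ ⊗-assoc-* p 1# x ⟨
      (p ⊗ 1#) * x    ≡⟨ cong (_* x) p⊗1≡0 ⟩
      0# * x          ≡⟨ R.zeroˡ x ⟩
      0#              ∎

    multiple⊗x≡0 : ∀ {m} → p ℕ.∣ m → ∀ x → m ⊗ x ≡ 0#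
    multiple⊗x≡0 (ℕ.divides k refl) x = begin
      (k ℕ.* p) ⊗ x   ≡⟨ cong (_⊗ x) (ℕ.*-comm k p) ⟩
      (p ℕ.* k) ⊗ x   ≡⟨ ⊗-assocˡ x p k ⟨
      p ⊗ (k ⊗ x)     ≡⟨ p⊗x≡0 (k ⊗ x) ⟩
      0#              ∎

    -- Only the two outer binomial terms survive; the exponent is a visible successor so that the
    -- index set splits into first, middle and last.
    expansion : ∀ p′ → p ≡ suc p′ → ∀ x y → binomialExpansion x y (suc p′) ≡ x Exp.^ suc p′ + y Exp.^ suc p′
    expansion p′ refl x y = begin
      term zero + +Sum.sum (tail term)
        ≡⟨ cong₂ _+_ first (+Sum.sum-init-last (tail term)) ⟩
      y Exp.^ suc p′ + (+Sum.sum (λ i → term (suc (inject₁ i))) + term (suc (fromℕ p′)))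
        ≡⟨ cong (_+_ (y Exp.^ suc p′)) (cong₂ _+_ (trans (+Sum.sum-cong-≗ middle) (+Sum.sum-replicate-zero p′)) last) ⟩
      y Exp.^ suc p′ + (0# + x Exp.^ suc p′)
        ≡⟨ cong (_+_ (y Exp.^ suc p′)) (R.+-identityˡ (x Exp.^ suc p′)) ⟩
      y Exp.^ suc p′ + x Exp.^ suc p′
        ≡⟨ R.+-comm (y Exp.^ suc p′) (x Exp.^ suc p′) ⟩
      x Exp.^ suc p′ + y Exp.^ suc p′
        ∎
      where
      term : Fin (suc (suc p′)) → Carrier
      term = binomialTerm x y (suc p′)
      first : term zero ≡ y Exp.^ suc p′
      first = trans (R.+-identityʳ _) (R.*-identityˡ (y Exp.^ suc p′))
      middle : ∀ i → term (suc (inject₁ i)) ≡ 0#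
      middle i = multiple⊗x≡0 (prime∣C prime (s≤s z≤n) (s≤s (subst (ℕ._< p′) (sym (Fin.toℕ-inject₁ i)) (Fin.toℕ<n i)))) _
      last : term (suc (fromℕ p′)) ≡ x Exp.^ suc p′
      last = begin
        term (suc (fromℕ p′))
          ≡⟨ cong (λ k → (suc p′ C suc k) ⊗ (x Exp.^ suc k * y Exp.^ (p′ ℕ.∸ k))) (Fin.toℕ-fromℕ p′) ⟩
        (suc p′ C suc p′) ⊗ (x Exp.^ suc p′ * y Exp.^ (p′ ℕ.∸ p′))
          ≡⟨ cong₂ (λ m k → m ⊗ (x Exp.^ suc p′ * y Exp.^ k)) (nCn≡1 (suc p′)) (ℕ.n∸n≡0 p′) ⟩
        x Exp.^ suc p′ * 1# + 0#
          ≡⟨ trans (R.+-identityʳ _) (R.*-identityʳ _) ⟩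
        x Exp.^ suc p′ ∎

    frobenius-+ : ∀ x y → (x + y) ^ p ≡ x ^ p + y ^ p
    frobenius-+ x y = begin
      (x + y) ^ p              ≡⟨ ^≡Exp^ (x + y) p ⟩
      (x + y) Exp.^ p          ≡⟨ binomialTheorem p x y ⟩
      binomialExpansion x y p  ≡⟨ expansion′ ⟩
      x Exp.^ p + y Exp.^ p    ≡⟨ cong₂ _+_ (^≡Exp^ x p) (^≡Exp^ y p) ⟨
      x ^ p + y ^ p            ∎
      where
      instance _ = prime⇒nonZero prime
      p≡ : p ≡ suc (ℕ.pred p)
      p≡ = sym (ℕ.suc-pred p)
      expansion′ : binomialExpansion x y p ≡ x Exp.^ p + y Exp.^ p
      expansion′ = subst (λ k → binomialExpansion x y k ≡ x Exp.^ k + y Exp.^ k) (sym p≡) (expansion (ℕ.pred p) p≡ x y)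

  -- The order of a primitive element

  module PrimitiveElement {β} (primitive-β : IsPrimitive β) where
    β≢0 : β ≢ 0#
    β≢0 = proj₁ primitive-β

    log : ∀ x → x ≢ 0# → ℕ
    log x x≢0 = proj₁ (proj₂ primitive-β x x≢0)

    β^log : ∀ x x≢0 → β ^ log x x≢0 ≡ x
    β^log x x≢0 = proj₂ (proj₂ primitive-β x x≢0)

    ^-periodic : ∀ {d} → β ^ d ≡ 1# → ∀ k m → β ^ (k ℕ.+ m ℕ.* d) ≡ β ^ k
    ^-periodic {d} β^d≡1 k m = begin
      β ^ (k ℕ.+ m ℕ.* d)      ≡⟨ ^-homo-* β k (m ℕ.* d) ⟩
      β ^ k * β ^ (m ℕ.* d)    ≡⟨ cong (λ j → β ^ k * β ^ j) (ℕ.*-comm m d) ⟩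
      β ^ k * β ^ (d ℕ.* m)    ≡⟨ cong (β ^ k *_) (^-assocʳ β d m) ⟨
      β ^ k * (β ^ d) ^ m      ≡⟨ cong (λ z → β ^ k * z ^ m) β^d≡1 ⟩
      β ^ k * 1# ^ m           ≡⟨ cong (β ^ k *_) (1^ m) ⟩
      β ^ k * 1#               ≡⟨ R.*-identityʳ (β ^ k) ⟩
      β ^ k                    ∎

    ^-% : ∀ {d} .{{_ : ℕ.NonZero d}} → β ^ d ≡ 1# → ∀ k → β ^ (k ℕ.% d) ≡ β ^ k
    ^-% {d} β^d≡1 k = begin
      β ^ (k ℕ.% d)                          ≡⟨ ^-periodic β^d≡1 (k ℕ.% d) (k ℕ./ d) ⟨
      β ^ (k ℕ.% d ℕ.+ k ℕ./ d ℕ.* d)        ≡⟨ cong (β ^_) (ℕ.m≡m%n+[m/n]*n k d) ⟨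
      β ^ k                                  ∎

    -- If β^d = 1 then 0, β^0, …, β^(d−1) exhaust the field.
    period-≥ : ∀ d .{{_ : ℕ.NonZero d}} → β ^ d ≡ 1# → q ℕ.≤ suc d
    period-≥ d β^d≡1 = Fin.injective⇒≤ {f = index ∘ elt} (elt-injective ∘ index-injective)
      where
      index : Carrier → Fin (suc d)
      index x with x ≟ 0#
      ... | yes _   = zero
      ... | no  x≢0 = suc (fromℕ< (ℕ.m%n<n (log x x≢0) d))
      value : Fin (suc d) → Carrier
      value zero    = 0#
      value (suc i) = β ^ toℕ i
      value-index : ∀ x → value (index x) ≡ x
      value-index x with x ≟ 0#
      ... | yes x≡0 = sym x≡0
      ... | no  x≢0 = begin
        β ^ toℕ (fromℕ< (ℕ.m%n<n (log x x≢0) d))   ≡⟨ cong (β ^_) (Fin.toℕ-fromℕ< (ℕ.m%n<n (log x x≢0) d)) ⟩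
        β ^ (log x x≢0 ℕ.% d)                      ≡⟨ ^-% β^d≡1 (log x x≢0) ⟩
        β ^ log x x≢0                              ≡⟨ β^log x x≢0 ⟩
        x                                          ∎
      index-injective : ∀ {x y} → index x ≡ index y → x ≡ y
      index-injective {x} {y} eq = trans (sym (value-index x)) (trans (cong value eq) (value-index y))

    quotient≡1 : ∀ {k l} → k ℕ.≤ l → β ^ k ≡ β ^ l → β ^ (l ℕ.∸ k) ≡ 1#
    quotient≡1 {k} {l} k≤l eq = *-cancelˡ (^-nonZero β≢0 k) (begin
      β ^ k * β ^ (l ℕ.∸ k)      ≡⟨ ^-homo-* β k (l ℕ.∸ k) ⟨
      β ^ (k ℕ.+ (l ℕ.∸ k))      ≡⟨ cong (β ^_) (ℕ.m+[n∸m]≡n k≤l) ⟩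
      β ^ l                      ≡⟨ eq ⟨
      β ^ k                      ≡⟨ R.*-identityʳ (β ^ k) ⟨
      β ^ k * 1#                 ∎)

    module _ {N} (q≡1+N : q ≡ suc N) where
      -- The q powers β^0, …, β^(q−1) avoid 0, so two of them coincide.
      slot≢ : ∀ (i : Fin (suc N)) → from 0# ≢ from (β ^ toℕ i)
      slot≢ i eq = ^-nonZero β≢0 (toℕ i) (sym (from-injective eq))

      cast-slot≢ : ∀ i → subst Fin q≡1+N (from 0#) ≢ subst Fin q≡1+N (from (β ^ toℕ i))
      cast-slot≢ i = slot≢ i ∘ subst-injective q≡1+N

      small-period : ∃[ d ] (ℕ.NonZero d × d ℕ.≤ N × β ^ d ≡ 1#)
      small-period with i , j , i<j , eq ← Fin.pigeonhole (ℕ.n<1+n N) (λ i → punchOut (cast-slot≢ i))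
        = toℕ j ℕ.∸ toℕ i , ℕ.>-nonZero (ℕ.m<n⇒0<n∸m i<j) , ℕ.≤-trans (ℕ.m∸n≤m (toℕ j) (toℕ i)) (Fin.toℕ≤pred[n] j)
        , quotient≡1 (ℕ.<⇒≤ i<j) (from-injective (subst-injective q≡1+N (Fin.punchOut-injective (cast-slot≢ i) (cast-slot≢ j) eq)))

      -- The period found by pigeonhole is at most N, and `period-≥` bounds it below by N.
      β^N≡1 : β ^ N ≡ 1#
      β^N≡1 with d , d≢0 , d≤N , β^d≡1 ← small-period
        = subst (λ k → β ^ k ≡ 1#) (ℕ.≤-antisym d≤N (ℕ.s≤s⁻¹ (subst (ℕ._≤ suc d) q≡1+N (period-≥ d {{d≢0}} β^d≡1)))) β^d≡1

      -- A nonzero remainder of d modulo N would again be a period, smaller than `period-≥` permits.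
      period-∣ : .{{_ : ℕ.NonZero N}} → ∀ d → β ^ d ≡ 1# → N ℕ.∣ d
      period-∣ d β^d≡1 with d ℕ.% N in eq
      ... | zero  = ℕ.m%n≡0⇒n∣m d N eq
      ... | suc e = contradiction (ℕ.s≤s⁻¹ (subst (ℕ._≤ suc (suc e)) q≡1+N (period-≥ (suc e) β^e≡1)))
                                  (ℕ.<⇒≱ (subst (ℕ._< N) eq (ℕ.m%n<n d N)))
        where
        β^e≡1 : β ^ suc e ≡ 1#
        β^e≡1 = trans (cong (β ^_) (sym eq)) (trans (^-% β^N≡1 d) β^d≡1)

      x^q≡x : ∀ x → x ^ q ≡ x
      x^q≡x x with x ≟ 0#
      ... | yes refl = trans (cong (0# ^_) q≡1+N) (0^ (suc N))
      ... | no  x≢0 = begin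
        x ^ q                ≡⟨ cong₂ _^_ (sym (β^log x x≢0)) q≡1+N ⟩
        (β ^ k) ^ suc N      ≡⟨ ^-assocʳ β k (suc N) ⟩
        β ^ (k ℕ.* suc N)    ≡⟨ cong (β ^_) (ℕ.*-suc k N) ⟩
        β ^ (k ℕ.+ k ℕ.* N)  ≡⟨ ^-periodic β^N≡1 k k ⟩
        β ^ k                ≡⟨ β^log x x≢0 ⟩
        x                    ∎
        where k = log x x≢0

-- The Peisert graph

-- quarter k is 1 exactly when β^k lies in S′ = C₀ ∪ C₁.
quarter : ℕ → ℤ
quarter 0 = 1ℤ
quarter 1 = 1ℤ
quarter 2 = 0ℤ
quarter 3 = 0ℤ
quarter (suc (suc (suc (suc k)))) = quarter k

quarter-periodic : ∀ k m → quarter (k ℕ.+ m ℕ.* 4) ≡ quarter k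
quarter-periodic k zero    = cong quarter (ℕ.+-identityʳ k)
quarter-periodic k (suc m) = trans (cong quarter (shift k (m ℕ.* 4))) (quarter-periodic k m)
  where
  shift : ∀ k l → k ℕ.+ (4 ℕ.+ l) ≡ 4 ℕ.+ (k ℕ.+ l)
  shift = ℕ-Solver.solve-∀

-- `h` records that r is even, which makes -1 a fourth power; `m₀` records p ≡ 3 modulo 4. The
-- exponent `suc e` makes p^e available for inverting the Frobenius map.
module PeisertGraph
  {q} (F : FiniteField q) {β} (primitive-β : FiniteField.IsPrimitive F β)
  {r h} (q≡1+4r : q ≡ suc (4 ℕ.* r)) (r≡2h : r ≡ 2 ℕ.* h) .{{r≢0 : ℕ.NonZero r}}
  {p e m₀} (prime : Prime p) (q≡p^1+e : q ≡ p ℕ.^ suc e) (p≡3+4m₀ : p ≡ 3 ℕ.+ m₀ ℕ.* 4)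
  where
  open FiniteField F
  open FieldProperties F
  open PrimitiveElement primitive-β
  open Frobenius {p} {suc e} prime q≡p^1+e
  open Algebra.Properties.Ring R.ring using (-‿distribʳ-*; -1*x≈-x; -‿involutive)

  private instance
    _ = ℕ.m*n≢0 4 r
    _ = prime⇒nonZero prime

  -- Exponents of one element differ by a multiple of q - 1 = 4r, hence of 4, so `quarter` descends
  -- to nonzero field elements.
  quarter-resp-≤ : ∀ {k l} → k ℕ.≤ l → β ^ k ≡ β ^ l → quarter l ≡ quarter k
  quarter-resp-≤ {k} {l} k≤l eq with ℕ.divides m l∸k≡ ← period-∣ q≡1+4r (l ℕ.∸ k) (quotient≡1 k≤l eq) = begin
    quarter l                            ≡⟨ cong quarter (ℕ.m+[n∸m]≡n k≤l) ⟨
    quarter (k ℕ.+ (l ℕ.∸ k))            ≡⟨ cong (λ d → quarter (k ℕ.+ d)) (trans l∸k≡ (regroup m r)) ⟩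
    quarter (k ℕ.+ (m ℕ.* r) ℕ.* 4)      ≡⟨ quarter-periodic k (m ℕ.* r) ⟩
    quarter k                            ∎
    where
    regroup : ∀ m r → m ℕ.* (4 ℕ.* r) ≡ (m ℕ.* r) ℕ.* 4
    regroup = ℕ-Solver.solve-∀

  quarter-resp-β^ : ∀ {k l} → β ^ k ≡ β ^ l → quarter k ≡ quarter l
  quarter-resp-β^ {k} {l} eq with ℕ.≤-total k l
  ... | inj₁ k≤l = sym (quarter-resp-≤ k≤l eq)
  ... | inj₂ l≤k = quarter-resp-≤ l≤k (sym eq)

  opaque
    -- The indicator of S′, not a multiplicative character. Opaque, so the chosen logarithm is
    -- hidden behind `χ-0` and `χ-β^`.
    χ : Carrier → ℤ
    χ x with x ≟ 0#
    ... | yes _   = 0ℤ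
    ... | no  x≢0 = quarter (log x x≢0)

    χ-0 : χ 0# ≡ 0ℤ
    χ-0 with 0# ≟ 0#
    ... | yes _   = refl
    ... | no  0≢0 = contradiction refl 0≢0

    χ-β^ : ∀ k → χ (β ^ k) ≡ quarter k
    χ-β^ k with (β ^ k) ≟ 0#
    ... | yes β^k≡0 = contradiction β^k≡0 (^-nonZero β≢0 k)
    ... | no  β^k≢0 = quarter-resp-β^ {log (β ^ k) β^k≢0} {k} (β^log (β ^ k) β^k≢0)

  -- A view of the field that reduces identities between class functions to the origin and four
  -- numerical cases.
  data Class : Carrier → Set where
    origin : Class 0#
    coset  : (a : Fin 4) (m : ℕ) → Class (β ^ (toℕ a ℕ.+ m ℕ.* 4))

  classify : ∀ x → Class x
  classify x with x ≟ 0#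
  ... | yes refl = origin
  ... | no  x≢0 with ℕ.result m a eq ← log x x≢0 ℕ.divMod 4
    = subst Class (trans (cong (β ^_) (sym eq)) (β^log x x≢0)) (coset a m)

  χ-coset : ∀ (a : Fin 4) m → χ (β ^ (toℕ a ℕ.+ m ℕ.* 4)) ≡ quarter (toℕ a)
  χ-coset a m = trans (χ-β^ (toℕ a ℕ.+ m ℕ.* 4)) (quarter-periodic (toℕ a) m)

  δ₀ : Carrier → ℤ
  δ₀ x = δ (from x) (from 0#)

  δ₀-0 : δ₀ 0# ≡ 1ℤ
  δ₀-0 = δ-diag (from 0#)

  δ₀-off : ∀ {x} → x ≢ 0# → δ₀ x ≡ 0ℤ
  δ₀-off x≢0 = δ-off (x≢0 ∘ from-injective)

  -- The indicator of β²C₀ ∪ β³C₀, the connection set of the complementary graph.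
  χ′ : Carrier → ℤ
  χ′ x = χ (β ^ 2 * x)

  χ′-0 : χ′ 0# ≡ 0ℤ
  χ′-0 = trans (cong χ (R.zeroʳ (β ^ 2))) χ-0

  χ′-coset : ∀ (a : Fin 4) m → χ′ (β ^ (toℕ a ℕ.+ m ℕ.* 4)) ≡ quarter (2 ℕ.+ toℕ a)
  χ′-coset a m = begin
    χ (β ^ 2 * β ^ (toℕ a ℕ.+ m ℕ.* 4))      ≡⟨ cong χ (^-homo-* β 2 (toℕ a ℕ.+ m ℕ.* 4)) ⟨
    χ (β ^ (2 ℕ.+ (toℕ a ℕ.+ m ℕ.* 4)))      ≡⟨ χ-β^ (2 ℕ.+ (toℕ a ℕ.+ m ℕ.* 4)) ⟩
    quarter (2 ℕ.+ toℕ a ℕ.+ m ℕ.* 4)        ≡⟨ quarter-periodic (2 ℕ.+ toℕ a) m ⟩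
    quarter (2 ℕ.+ toℕ a)                    ∎

  coset≢0 : ∀ k → β ^ k ≢ 0#
  coset≢0 = ^-nonZero β≢0

  complement : (Carrier → ℤ) → Carrier → ℤ
  complement g x = 1ℤ ℤ.* 1ℤ ℤ.+ ℤ.- 1ℤ ℤ.* (1ℤ ℤ.* δ₀ x ℤ.+ 1ℤ ℤ.* g x)

  χ′-complement : ∀ x → χ′ x ≡ complement χ x
  χ′-complement x with classify x
  ... | origin = trans χ′-0 (cong₂ (λ y z → 1ℤ ℤ.* 1ℤ ℤ.+ ℤ.- 1ℤ ℤ.* (1ℤ ℤ.* y ℤ.+ 1ℤ ℤ.* z)) (sym δ₀-0) (sym χ-0))
  ... | coset a m = trans (χ′-coset a m) (trans (values a)
          (cong₂ (λ y z → 1ℤ ℤ.* 1ℤ ℤ.+ ℤ.- 1ℤ ℤ.* (1ℤ ℤ.* y ℤ.+ 1ℤ ℤ.* z)) (sym (δ₀-off (coset≢0 (toℕ a ℕ.+ m ℕ.* 4)))) (sym (χ-coset a m))))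
    where
    values : ∀ (a : Fin 4) → quarter (2 ℕ.+ toℕ a) ≡ 1ℤ ℤ.* 1ℤ ℤ.+ ℤ.- 1ℤ ℤ.* (1ℤ ℤ.* 0ℤ ℤ.+ 1ℤ ℤ.* quarter (toℕ a))
    values 0F = refl
    values 1F = refl
    values 2F = refl
    values 3F = refl

  χ-fourthPower : ∀ m x → χ (β ^ (m ℕ.* 4) * x) ≡ χ x
  χ-fourthPower m x with classify x
  ... | origin = cong χ (R.zeroʳ (β ^ (m ℕ.* 4)))
  ... | coset a l = begin
    χ (β ^ (m ℕ.* 4) * β ^ (toℕ a ℕ.+ l ℕ.* 4))    ≡⟨ cong χ (^-homo-* β (m ℕ.* 4) (toℕ a ℕ.+ l ℕ.* 4)) ⟨
    χ (β ^ (m ℕ.* 4 ℕ.+ (toℕ a ℕ.+ l ℕ.* 4)))      ≡⟨ cong (χ ∘ (β ^_)) (regroup m (toℕ a) l) ⟩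
    χ (β ^ (toℕ a ℕ.+ (m ℕ.+ l) ℕ.* 4))            ≡⟨ χ-coset a (m ℕ.+ l) ⟩
    quarter (toℕ a)                                ≡⟨ χ-coset a l ⟨
    χ (β ^ (toℕ a ℕ.+ l ℕ.* 4))                    ∎
    where
    regroup : ∀ m a l → m ℕ.* 4 ℕ.+ (a ℕ.+ l ℕ.* 4) ≡ a ℕ.+ (m ℕ.+ l) ℕ.* 4
    regroup = ℕ-Solver.solve-∀

  opaque
    -- If j is a logarithm of -1, then 2j is a multiple of 4r = 8h, so 4 divides j.
    -1-fourthPower : ∃[ m ] - 1# ≡ β ^ (m ℕ.* 4)
    -1-fourthPower = m , trans (sym (β^log (- 1#) -1≢0)) (cong (β ^_) j≡)
      where
      -1≢0 : - 1# ≢ 0#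
      -1≢0 -1≡0 = 0≢1 (begin
        0#         ≡⟨ R.-‿inverseʳ 1# ⟨
        1# - 1#    ≡⟨ cong (_+_ 1#) -1≡0 ⟩
        1# + 0#    ≡⟨ R.+-identityʳ 1# ⟩
        1#         ∎)
      j : ℕ
      j = log (- 1#) -1≢0
      β^2j≡1 : β ^ (j ℕ.+ j) ≡ 1#
      β^2j≡1 = begin
        β ^ (j ℕ.+ j)      ≡⟨ ^-homo-* β j j ⟩
        β ^ j * β ^ j      ≡⟨ cong₂ _*_ (β^log (- 1#) -1≢0) (β^log (- 1#) -1≢0) ⟩
        - 1# * - 1#        ≡⟨ -1*x≈-x (- 1#) ⟩
        - (- 1#)           ≡⟨ -‿involutive 1# ⟩
        1#                 ∎
      4r∣j+j : 4 ℕ.* r ℕ.∣ j ℕ.+ j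
      4r∣j+j = period-∣ q≡1+4r (j ℕ.+ j) β^2j≡1
      m : ℕ
      m = ℕ.quotient 4r∣j+j ℕ.* h
      j≡ : j ≡ m ℕ.* 4
      j≡ = ℕ.*-cancelˡ-≡ j (m ℕ.* 4) 2 (begin
        2 ℕ.* j                                     ≡⟨ cong (j ℕ.+_) (ℕ.+-identityʳ j) ⟩
        j ℕ.+ j                                     ≡⟨ ℕ._∣_.equality 4r∣j+j ⟩
        ℕ.quotient 4r∣j+j ℕ.* (4 ℕ.* r)             ≡⟨ cong (λ z → ℕ.quotient 4r∣j+j ℕ.* (4 ℕ.* z)) r≡2h ⟩
        ℕ.quotient 4r∣j+j ℕ.* (4 ℕ.* (2 ℕ.* h))     ≡⟨ regroup (ℕ.quotient 4r∣j+j) h ⟩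
        2 ℕ.* (m ℕ.* 4)                             ∎)
        where
        regroup : ∀ k h → k ℕ.* (4 ℕ.* (2 ℕ.* h)) ≡ 2 ℕ.* (k ℕ.* h ℕ.* 4)
        regroup = ℕ-Solver.solve-∀

  χ-neg : ∀ x → χ (0# - x) ≡ χ x
  χ-neg x with m , -1≡ ← -1-fourthPower = begin
    χ (0# - x)               ≡⟨ cong χ (R.+-identityˡ (- x)) ⟩
    χ (- x)                  ≡⟨ cong χ (-1*x≈-x x) ⟨
    χ (- 1# * x)             ≡⟨ cong (λ c → χ (c * x)) -1≡ ⟩
    χ (β ^ (m ℕ.* 4) * x)    ≡⟨ χ-fourthPower m x ⟩
    χ x                      ∎

  -- Summation and convolution on the additive group

  sum-reindex : ∀ (φ : Carrier ↔ Carrier) (g : Carrier → ℤ) →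
                ∑[ i < q ] g (Inverse.to φ (elt i)) ≡ ∑[ i < q ] g (elt i)
  sum-reindex φ g = begin
    ∑[ i < q ] g (Inverse.to φ (elt i))              ≡⟨ sum-cong-≗ (λ i → cong g (elt-from (Inverse.to φ (elt i)))) ⟨
    ∑[ i < q ] g (elt (from (Inverse.to φ (elt i)))) ≡⟨ ∑-permute (g ∘ elt) (reindex φ) ⟨
    ∑[ i < q ] g (elt i)                             ∎

  reflection : Carrier → Carrier ↔ Carrier
  reflection a = mk↔ₛ′ (_-_ a) (_-_ a) (a-[a-x]≡x a) (a-[a-x]≡x a)

  translation : Carrier → Carrier ↔ Carrier
  translation a = mk↔ₛ′ (_- a) (_+ a) (//-rightDividesʳ a) (//-rightDividesˡ a)

  ∫ : (Carrier → ℤ) → ℤ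
  ∫ g = 𝟙 ∙ (g ∘ elt)

  ∫≡sum : ∀ g → ∫ g ≡ ∑[ i < q ] g (elt i)
  ∫≡sum g = trans (∙-sum 𝟙 (g ∘ elt)) (sum-cong-≗ (λ i → ℤ.*-identityˡ (g (elt i))))

  ∫-reindex : ∀ (φ : Carrier ↔ Carrier) g → ∫ (g ∘ Inverse.to φ) ≡ ∫ g
  ∫-reindex φ g = trans (∫≡sum (g ∘ Inverse.to φ)) (trans (sum-reindex φ g) (sym (∫≡sum g)))

  infixl 7 _⋆_
  _⋆_ : (g h : Carrier → ℤ) → Carrier → ℤ
  (g ⋆ h) d = (g ∘ elt) ∙ (λ i → h (d - elt i))

  ⋆≡sum : ∀ g h d → (g ⋆ h) d ≡ ∑[ i < q ] (g (elt i) ℤ.* h (d - elt i))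
  ⋆≡sum g h d = ∙-sum (g ∘ elt) (λ i → h (d - elt i))

  ⋆-cong : ∀ {g g′ h h′} → g ≗ g′ → h ≗ h′ → g ⋆ h ≗ g′ ⋆ h′
  ⋆-cong {g′ = g′} {h} g≗ h≗ d =
    trans (∙-congʳ (λ i → h (d - elt i)) (g≗ ∘ elt)) (∙-congˡ (g′ ∘ elt) (λ i → h≗ (d - elt i)))

  ⋆-comm : ∀ g h → g ⋆ h ≗ h ⋆ g
  ⋆-comm g h d = begin
    (g ⋆ h) d
      ≡⟨ ⋆≡sum g h d ⟩
    ∑[ i < q ] (g (elt i) ℤ.* h (d - elt i))
      ≡⟨ sum-reindex (reflection d) (λ w → g w ℤ.* h (d - w)) ⟨
    ∑[ i < q ] (g (d - elt i) ℤ.* h (d - (d - elt i)))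
      ≡⟨ sum-cong-≗ (λ i → trans (ℤ.*-comm (g (d - elt i)) _) (cong (λ w → h w ℤ.* g (d - elt i)) (a-[a-x]≡x d (elt i)))) ⟩
    ∑[ i < q ] (h (elt i) ℤ.* g (d - elt i))
      ≡⟨ ⋆≡sum h g d ⟨
    (h ⋆ g) d
      ∎

  1⋆ : ∀ h d → ((λ _ → 1ℤ) ⋆ h) d ≡ ∫ h
  1⋆ h d = ∫-reindex (reflection d) h

  δ₀⋆ : ∀ h d → (δ₀ ⋆ h) d ≡ h d
  δ₀⋆ h d = begin
    (δ₀ ∘ elt) ∙ v                    ≡⟨ ∙-congʳ v (λ i → cong (λ j → δ j (from 0#)) (from-elt i)) ⟩
    (λ i → δ i (from 0#)) ∙ v         ≡⟨ ∙-comm _ v ⟩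
    v ∙ (λ i → δ i (from 0#))         ≡⟨ ∙-basisʳ v (from 0#) ⟩
    h (d - elt (from 0#))             ≡⟨ cong (λ z → h (d - z)) (elt-from 0#) ⟩
    h (d - 0#)                        ≡⟨ cong (λ z → h (d + z)) -0≡0 ⟩
    h (d + 0#)                        ≡⟨ cong h (R.+-identityʳ d) ⟩
    h d                               ∎
    where
    v : Vector ℤ q
    v i = h (d - elt i)
    -0≡0 : - 0# ≡ 0#
    -0≡0 = trans (sym (R.+-identityˡ (- 0#))) (R.-‿inverseʳ 0#)

  ∫δ₀ : ∫ δ₀ ≡ 1ℤ
  ∫δ₀ = trans (∙-comm 𝟙 (δ₀ ∘ elt)) (δ₀⋆ (λ _ → 1ℤ) 0#)

  complement-⋆ : ∀ g h d → (complement g ⋆ h) d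
                 ≡ 1ℤ ℤ.* ∫ h ℤ.+ ℤ.- 1ℤ ℤ.* (1ℤ ℤ.* h d ℤ.+ 1ℤ ℤ.* (g ⋆ h) d)
  complement-⋆ g h d = begin
    (complement g ⋆ h) d
      ≡⟨ ∙-linearˡ 1ℤ (ℤ.- 1ℤ) 𝟙 (λ i → 1ℤ ℤ.* δ₀ (elt i) ℤ.+ 1ℤ ℤ.* g (elt i)) (λ i → h (d - elt i)) ⟩
    1ℤ ℤ.* ((λ _ → 1ℤ) ⋆ h) d ℤ.+ ℤ.- 1ℤ ℤ.* ((λ x → 1ℤ ℤ.* δ₀ x ℤ.+ 1ℤ ℤ.* g x) ⋆ h) d
      ≡⟨ cong₂ (λ y z → 1ℤ ℤ.* y ℤ.+ ℤ.- 1ℤ ℤ.* z) (1⋆ h d) (∙-linearˡ 1ℤ 1ℤ (δ₀ ∘ elt) (g ∘ elt) (λ i → h (d - elt i))) ⟩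
    1ℤ ℤ.* ∫ h ℤ.+ ℤ.- 1ℤ ℤ.* (1ℤ ℤ.* (δ₀ ⋆ h) d ℤ.+ 1ℤ ℤ.* (g ⋆ h) d)
      ≡⟨ cong (λ y → 1ℤ ℤ.* ∫ h ℤ.+ ℤ.- 1ℤ ℤ.* (1ℤ ℤ.* y ℤ.+ 1ℤ ℤ.* (g ⋆ h) d)) (δ₀⋆ h d) ⟩
    1ℤ ℤ.* ∫ h ℤ.+ ℤ.- 1ℤ ℤ.* (1ℤ ℤ.* h d ℤ.+ 1ℤ ℤ.* (g ⋆ h) d)
      ∎

  Additive : (Carrier → Carrier) → Set
  Additive φ = ∀ x y → φ (x - y) ≡ φ x - φ y

  -- An additive bijection permutes the summation variable and respects d - x. Hence every such
  -- symmetry of χ is a symmetry of χ ⋆ χ.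
  ⋆-automorphism : ∀ (φ : Carrier ↔ Carrier) → Additive (Inverse.to φ) → ∀ g h d →
                   (g ⋆ h) (Inverse.to φ d) ≡ ((g ∘ Inverse.to φ) ⋆ (h ∘ Inverse.to φ)) d
  ⋆-automorphism φ additive g h d = begin
    (g ⋆ h) (to d)
      ≡⟨ ⋆≡sum g h (to d) ⟩
    ∑[ i < q ] (g (elt i) ℤ.* h (to d - elt i))
      ≡⟨ sum-reindex φ (λ w → g w ℤ.* h (to d - w)) ⟨
    ∑[ i < q ] (g (to (elt i)) ℤ.* h (to d - to (elt i)))
      ≡⟨ sum-cong-≗ (λ i → cong (λ z → g (to (elt i)) ℤ.* h z) (additive d (elt i))) ⟨
    ∑[ i < q ] (g (to (elt i)) ℤ.* h (to (d - elt i)))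
      ≡⟨ ⋆≡sum (g ∘ to) (h ∘ to) d ⟨
    ((g ∘ to) ⋆ (h ∘ to)) d
      ∎
    where open Inverse φ using (to)

  cancel-inverse : ∀ {b b⁻¹} → b * b⁻¹ ≡ 1# → ∀ x → b * (b⁻¹ * x) ≡ x
  cancel-inverse {b} {b⁻¹} bb⁻¹≡1 x = begin
    b * (b⁻¹ * x)  ≡⟨ R.*-assoc b b⁻¹ x ⟨
    b * b⁻¹ * x    ≡⟨ cong (_* x) bb⁻¹≡1 ⟩
    1# * x         ≡⟨ R.*-identityˡ x ⟩
    x              ∎

  dilation : ∀ {b} → b ≢ 0# → Carrier ↔ Carrier
  dilation {b} b≢0 with b⁻¹ , bb⁻¹≡1 ← inverse b b≢0 =
    mk↔ₛ′ (b *_) (b⁻¹ *_) (cancel-inverse bb⁻¹≡1) (cancel-inverse (trans (R.*-comm b⁻¹ b) bb⁻¹≡1))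

  *-additive : ∀ b → Additive (b *_)
  *-additive b x y = trans (R.distribˡ b x (- y)) (cong (_+_ (b * x)) (sym (-‿distribʳ-* b y)))

  -- x ↦ βx^p interchanges C₀ and C₁, and also C₂ and C₃, because p ≡ 3 (mod 4).
  ψ : Carrier ↔ Carrier
  -- Raising to the power p^e inverts Frobenius, because p · p^e = q and x^q = x.
  ψ with β⁻¹ , ββ⁻¹≡1 ← inverse β β≢0 = mk↔ₛ′ (λ x → β * x ^ p) (λ y → (β⁻¹ * y) ^ (p ℕ.^ e)) left right
    where
    x^p^p^e≡x : ∀ x → (x ^ p) ^ (p ℕ.^ e) ≡ x
    x^p^p^e≡x x = trans (^-assocʳ x p (p ℕ.^ e)) (trans (cong (x ^_) (sym q≡p^1+e)) (x^q≡x q≡1+4r x))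
    left : ∀ y → β * ((β⁻¹ * y) ^ (p ℕ.^ e)) ^ p ≡ y
    left y = begin
      β * ((β⁻¹ * y) ^ (p ℕ.^ e)) ^ p   ≡⟨ cong (β *_) (^-assocʳ (β⁻¹ * y) (p ℕ.^ e) p) ⟩
      β * (β⁻¹ * y) ^ (p ℕ.^ e ℕ.* p)   ≡⟨ cong (λ k → β * (β⁻¹ * y) ^ k) (ℕ.*-comm (p ℕ.^ e) p) ⟩
      β * (β⁻¹ * y) ^ (p ℕ.* p ℕ.^ e)   ≡⟨ cong (β *_) (^-assocʳ (β⁻¹ * y) p (p ℕ.^ e)) ⟨
      β * ((β⁻¹ * y) ^ p) ^ (p ℕ.^ e)   ≡⟨ cong (β *_) (x^p^p^e≡x (β⁻¹ * y)) ⟩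
      β * (β⁻¹ * y)                     ≡⟨ cancel-inverse ββ⁻¹≡1 y ⟩
      y                                 ∎
    right : ∀ x → (β⁻¹ * (β * x ^ p)) ^ (p ℕ.^ e) ≡ x
    right x = trans (cong (_^ (p ℕ.^ e)) (cancel-inverse (trans (R.*-comm β⁻¹ β) ββ⁻¹≡1) (x ^ p))) (x^p^p^e≡x x)

  ψ-additive : Additive (λ x → β * x ^ p)
  ψ-additive x y = begin
    β * (x - y) ^ p          ≡⟨ cong (β *_) (x≈z//y ((x - y) ^ p) (y ^ p) (x ^ p) (begin
                                   (x - y) ^ p + y ^ p   ≡⟨ frobenius-+ (x - y) y ⟨
                                   (x - y + y) ^ p       ≡⟨ cong (_^ p) (//-rightDividesˡ y x) ⟩
                                   x ^ p                 ∎)) ⟩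
    β * (x ^ p - y ^ p)      ≡⟨ *-additive β (x ^ p) (y ^ p) ⟩
    β * x ^ p - β * y ^ p    ∎

  ψ-β^ : ∀ k → β * (β ^ k) ^ p ≡ β ^ suc (k ℕ.* p)
  ψ-β^ k = cong (β *_) (^-assocʳ β k p)

  -- On exponents modulo 4 the map is k ↦ 1 + 3k, and `quarter` agrees on the swapped pairs.
  χ-ψ : ∀ x → χ (β * x ^ p) ≡ χ x
  χ-ψ x with classify x
  ... | origin = cong χ (trans (cong (β *_) (0^ p)) (R.zeroʳ β))
  ... | coset a m = begin
    χ (β * (β ^ (toℕ a ℕ.+ m ℕ.* 4)) ^ p)
      ≡⟨ cong χ (ψ-β^ (toℕ a ℕ.+ m ℕ.* 4)) ⟩
    χ (β ^ suc ((toℕ a ℕ.+ m ℕ.* 4) ℕ.* p))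
      ≡⟨ χ-β^ (suc ((toℕ a ℕ.+ m ℕ.* 4) ℕ.* p)) ⟩
    quarter (suc ((toℕ a ℕ.+ m ℕ.* 4) ℕ.* p))
      ≡⟨ cong (λ z → quarter (suc ((toℕ a ℕ.+ m ℕ.* 4) ℕ.* z))) p≡3+4m₀ ⟩
    quarter (suc ((toℕ a ℕ.+ m ℕ.* 4) ℕ.* (3 ℕ.+ m₀ ℕ.* 4)))
      ≡⟨ cong quarter (regroup (toℕ a) m m₀) ⟩
    quarter (suc (toℕ a ℕ.* 3) ℕ.+ (toℕ a ℕ.* m₀ ℕ.+ m ℕ.* (3 ℕ.+ m₀ ℕ.* 4)) ℕ.* 4)
      ≡⟨ quarter-periodic (suc (toℕ a ℕ.* 3)) (toℕ a ℕ.* m₀ ℕ.+ m ℕ.* (3 ℕ.+ m₀ ℕ.* 4)) ⟩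
    quarter (suc (toℕ a ℕ.* 3))
      ≡⟨ values a ⟩
    quarter (toℕ a)
      ≡⟨ χ-coset a m ⟨
    χ (β ^ (toℕ a ℕ.+ m ℕ.* 4))
      ∎
    where
    regroup : ∀ a m m₀ → suc ((a ℕ.+ m ℕ.* 4) ℕ.* (3 ℕ.+ m₀ ℕ.* 4)) ≡ suc (a ℕ.* 3) ℕ.+ (a ℕ.* m₀ ℕ.+ m ℕ.* (3 ℕ.+ m₀ ℕ.* 4)) ℕ.* 4
    regroup = ℕ-Solver.solve-∀
    values : ∀ (a : Fin 4) → quarter (suc (toℕ a ℕ.* 3)) ≡ quarter (toℕ a)
    values 0F = refl
    values 1F = refl
    values 2F = refl
    values 3F = refl

  -- Counting neighbours and common neighbours

  ∫χ≡2r : ∫ χ ≡ + 2 ℤ.* + r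
  ∫χ≡2r = ℤ.*-cancelˡ-≡ (+ 2) (∫ χ) (+ 2 ℤ.* + r) (begin
    + 2 ℤ.* ∫ χ
      ≡⟨ double (∫ χ) ⟩
    ∫ χ ℤ.+ ∫ χ
      -- Dilation by β² shows ∫ χ′ = ∫ χ, and the complement formula makes the two add up to q - 1.
      ≡⟨ cong (ℤ._+ ∫ χ) (∫-reindex (dilation (coset≢0 2)) χ) ⟨
    ∫ χ′ ℤ.+ ∫ χ
      ≡⟨ cong (ℤ._+ ∫ χ) ∫χ′ ⟩
    1ℤ ℤ.* + q ℤ.+ ℤ.- 1ℤ ℤ.* (1ℤ ℤ.* 1ℤ ℤ.+ 1ℤ ℤ.* ∫ χ) ℤ.+ ∫ χ
      ≡⟨ cancel (+ q) (∫ χ) ⟩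
    + q ℤ.- 1ℤ
      ≡⟨ cong (ℤ._- 1ℤ) (trans (cong +_ q≡1+4r) (cong (ℤ._+_ 1ℤ) (ℤ.pos-* 4 r))) ⟩
    1ℤ ℤ.+ + 4 ℤ.* + r ℤ.- 1ℤ
      ≡⟨ halve (+ r) ⟩
    + 2 ℤ.* (+ 2 ℤ.* + r)
      ∎)
    where
    double : ∀ x → + 2 ℤ.* x ≡ x ℤ.+ x
    double = solve-∀
    cancel : ∀ n x → 1ℤ ℤ.* n ℤ.+ ℤ.- 1ℤ ℤ.* (1ℤ ℤ.* 1ℤ ℤ.+ 1ℤ ℤ.* x) ℤ.+ x ≡ n ℤ.- 1ℤ
    cancel = solve-∀
    halve : ∀ r → 1ℤ ℤ.+ + 4 ℤ.* r ℤ.- 1ℤ ≡ + 2 ℤ.* (+ 2 ℤ.* r)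
    halve = solve-∀
    ∫χ′ : ∫ χ′ ≡ 1ℤ ℤ.* + q ℤ.+ ℤ.- 1ℤ ℤ.* (1ℤ ℤ.* 1ℤ ℤ.+ 1ℤ ℤ.* ∫ χ)
    ∫χ′ = begin
      ∫ χ′
        ≡⟨ ∙-congˡ 𝟙 (χ′-complement ∘ elt) ⟩
      𝟙 ∙ (λ i → 1ℤ ℤ.* 𝟙 i ℤ.+ ℤ.- 1ℤ ℤ.* (1ℤ ℤ.* δ₀ (elt i) ℤ.+ 1ℤ ℤ.* χ (elt i)))
        ≡⟨ ∙-linearʳ 1ℤ (ℤ.- 1ℤ) 𝟙 𝟙 (λ i → 1ℤ ℤ.* δ₀ (elt i) ℤ.+ 1ℤ ℤ.* χ (elt i)) ⟩
      1ℤ ℤ.* 𝟙 {q} ∙ 𝟙 ℤ.+ ℤ.- 1ℤ ℤ.* 𝟙 ∙ (λ i → 1ℤ ℤ.* δ₀ (elt i) ℤ.+ 1ℤ ℤ.* χ (elt i))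
        ≡⟨ cong₂ (λ y z → 1ℤ ℤ.* y ℤ.+ ℤ.- 1ℤ ℤ.* z) (𝟙∙𝟙≡n q) (∙-linearʳ 1ℤ 1ℤ 𝟙 (δ₀ ∘ elt) (χ ∘ elt)) ⟩
      1ℤ ℤ.* + q ℤ.+ ℤ.- 1ℤ ℤ.* (1ℤ ℤ.* ∫ δ₀ ℤ.+ 1ℤ ℤ.* ∫ χ)
        ≡⟨ cong (λ y → 1ℤ ℤ.* + q ℤ.+ ℤ.- 1ℤ ℤ.* (1ℤ ℤ.* y ℤ.+ 1ℤ ℤ.* ∫ χ)) ∫δ₀ ⟩
      1ℤ ℤ.* + q ℤ.+ ℤ.- 1ℤ ℤ.* (1ℤ ℤ.* 1ℤ ℤ.+ 1ℤ ℤ.* ∫ χ)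
        ∎

  ∫χ′≡2r : ∫ χ′ ≡ + 2 ℤ.* + r
  ∫χ′≡2r = trans (∫-reindex (dilation (coset≢0 2)) χ) ∫χ≡2r

  -- common (x − y) is the number of common neighbours of x and y.
  common : Carrier → ℤ
  common = χ ⋆ χ

  common-fourthPower : ∀ k m → common (β ^ (k ℕ.+ m ℕ.* 4)) ≡ common (β ^ k)
  common-fourthPower k m = begin
    common (β ^ (k ℕ.+ m ℕ.* 4))        ≡⟨ cong (common ∘ (β ^_)) (ℕ.+-comm k (m ℕ.* 4)) ⟩
    common (β ^ (m ℕ.* 4 ℕ.+ k))        ≡⟨ cong common (^-homo-* β (m ℕ.* 4) k) ⟩
    common (β ^ (m ℕ.* 4) * β ^ k)      ≡⟨ ⋆-automorphism (dilation (coset≢0 (m ℕ.* 4))) (*-additive (β ^ (m ℕ.* 4))) χ χ (β ^ k) ⟩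
    ((χ ∘ (β ^ (m ℕ.* 4) *_)) ⋆ (χ ∘ (β ^ (m ℕ.* 4) *_))) (β ^ k)
                                        ≡⟨ ⋆-cong (χ-fourthPower m) (χ-fourthPower m) (β ^ k) ⟩
    common (β ^ k)                      ∎

  common-ψ : ∀ k → common (β ^ suc (k ℕ.* p)) ≡ common (β ^ k)
  common-ψ k = begin
    common (β ^ suc (k ℕ.* p))          ≡⟨ cong common (ψ-β^ k) ⟨
    common (β * (β ^ k) ^ p)            ≡⟨ ⋆-automorphism ψ ψ-additive χ χ (β ^ k) ⟩
    ((χ ∘ (λ x → β * x ^ p)) ⋆ (χ ∘ (λ x → β * x ^ p))) (β ^ k)
                                        ≡⟨ ⋆-cong χ-ψ χ-ψ (β ^ k) ⟩
    common (β ^ k)                      ∎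

  -- By 1 + 2p = 3 + 4(1 + 2m₀), the map x ↦ βx^p carries β² into the coset of β³.
  common-β^3 : common (β ^ 3) ≡ common (β ^ 2)
  common-β^3 = begin
    common (β ^ 3)                                       ≡⟨ common-fourthPower 3 (suc (2 ℕ.* m₀)) ⟨
    common (β ^ (3 ℕ.+ suc (2 ℕ.* m₀) ℕ.* 4))            ≡⟨ cong (common ∘ (β ^_)) (regroup m₀) ⟩
    common (β ^ suc (2 ℕ.* (3 ℕ.+ m₀ ℕ.* 4)))            ≡⟨ cong (λ z → common (β ^ suc (2 ℕ.* z))) p≡3+4m₀ ⟨
    common (β ^ suc (2 ℕ.* p))                           ≡⟨ common-ψ 2 ⟩
    common (β ^ 2)                                       ∎
    where
    regroup : ∀ m → 3 ℕ.+ suc (2 ℕ.* m) ℕ.* 4 ≡ suc (2 ℕ.* (3 ℕ.+ m ℕ.* 4))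
    regroup = ℕ-Solver.solve-∀

  -- The complementary connection set is β²S′, so the complement has the same
  -- number of common neighbours up to dilation by β².
  common-complement : ∀ d → common (β ^ 2 * d) ≡ common d ℤ.+ χ d ℤ.- χ′ d
  common-complement d = begin
    common (β ^ 2 * d)
      ≡⟨ ⋆-automorphism (dilation (coset≢0 2)) (*-additive (β ^ 2)) χ χ d ⟩
    (χ′ ⋆ χ′) d
      ≡⟨ ⋆-cong {χ′} {complement χ} {χ′} {χ′} χ′-complement (λ _ → refl) d ⟩
    (complement χ ⋆ χ′) d
      ≡⟨ complement-⋆ χ χ′ d ⟩
    1ℤ ℤ.* ∫ χ′ ℤ.+ ℤ.- 1ℤ ℤ.* (1ℤ ℤ.* χ′ d ℤ.+ 1ℤ ℤ.* (χ ⋆ χ′) d)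
      ≡⟨ cong₂ (λ y z → 1ℤ ℤ.* y ℤ.+ ℤ.- 1ℤ ℤ.* (1ℤ ℤ.* χ′ d ℤ.+ 1ℤ ℤ.* z)) ∫χ′≡2r χ⋆χ′ ⟩
    1ℤ ℤ.* (+ 2 ℤ.* + r) ℤ.+ ℤ.- 1ℤ ℤ.* (1ℤ ℤ.* χ′ d ℤ.+ 1ℤ ℤ.* (1ℤ ℤ.* (+ 2 ℤ.* + r) ℤ.+ ℤ.- 1ℤ ℤ.* (1ℤ ℤ.* χ d ℤ.+ 1ℤ ℤ.* common d)))
      ≡⟨ polynomial (+ 2 ℤ.* + r) (χ d) (χ′ d) (common d) ⟩
    common d ℤ.+ χ d ℤ.- χ′ d
      ∎
    where
    χ⋆χ′ : (χ ⋆ χ′) d ≡ 1ℤ ℤ.* (+ 2 ℤ.* + r) ℤ.+ ℤ.- 1ℤ ℤ.* (1ℤ ℤ.* χ d ℤ.+ 1ℤ ℤ.* common d)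
    χ⋆χ′ = begin
      (χ ⋆ χ′) d            ≡⟨ ⋆-comm χ χ′ d ⟩
      (χ′ ⋆ χ) d            ≡⟨ ⋆-cong {χ′} {complement χ} {χ} {χ} χ′-complement (λ _ → refl) d ⟩
      (complement χ ⋆ χ) d    ≡⟨ complement-⋆ χ χ d ⟩
      1ℤ ℤ.* ∫ χ ℤ.+ ℤ.- 1ℤ ℤ.* (1ℤ ℤ.* χ d ℤ.+ 1ℤ ℤ.* common d)
        ≡⟨ cong (λ y → 1ℤ ℤ.* y ℤ.+ ℤ.- 1ℤ ℤ.* (1ℤ ℤ.* χ d ℤ.+ 1ℤ ℤ.* common d)) ∫χ≡2r ⟩
      1ℤ ℤ.* (+ 2 ℤ.* + r) ℤ.+ ℤ.- 1ℤ ℤ.* (1ℤ ℤ.* χ d ℤ.+ 1ℤ ℤ.* common d) ∎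
    polynomial : ∀ k x y c → 1ℤ ℤ.* k ℤ.+ ℤ.- 1ℤ ℤ.* (1ℤ ℤ.* y ℤ.+ 1ℤ ℤ.* (1ℤ ℤ.* k ℤ.+ ℤ.- 1ℤ ℤ.* (1ℤ ℤ.* x ℤ.+ 1ℤ ℤ.* c))) ≡ c ℤ.+ x ℤ.- y
    polynomial = solve-∀

  -- The number of common neighbours of two adjacent vertices, unknown until the double count in
  -- `λ₁≡r-1`.
  λ₁ : ℤ
  λ₁ = common 1#

  common-β^2 : common (β ^ 2) ≡ λ₁ ℤ.+ 1ℤ
  common-β^2 = begin
    common (β ^ 2)                ≡⟨ cong common (R.*-identityʳ (β ^ 2)) ⟨
    common (β ^ 2 * 1#)           ≡⟨ common-complement 1# ⟩
    λ₁ ℤ.+ χ 1# ℤ.- χ′ 1#         ≡⟨ cong₂ (λ y z → λ₁ ℤ.+ y ℤ.- z) (χ-coset 0F 0) (χ′-coset 0F 0) ⟩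
    λ₁ ℤ.+ 1ℤ ℤ.+ 0ℤ              ≡⟨ ℤ.+-identityʳ (λ₁ ℤ.+ 1ℤ) ⟩
    λ₁ ℤ.+ 1ℤ                     ∎

  common-0 : common 0# ≡ + 2 ℤ.* + r
  common-0 = begin
    common 0#                                        ≡⟨ ⋆≡sum χ χ 0# ⟩
    ∑[ i < q ] (χ (elt i) ℤ.* χ (0# - elt i))        ≡⟨ sum-cong-≗ (λ i → trans (cong (χ (elt i) ℤ.*_) (χ-neg (elt i))) (idempotent (elt i))) ⟩
    ∑[ i < q ] χ (elt i)                             ≡⟨ ∫≡sum χ ⟨
    ∫ χ                                              ≡⟨ ∫χ≡2r ⟩
    + 2 ℤ.* + r                                      ∎
    where
    idempotent : ∀ x → χ x ℤ.* χ x ≡ χ x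
    idempotent x with classify x
    ... | origin = trans (cong₂ ℤ._*_ χ-0 χ-0) (sym χ-0)
    ... | coset a m = trans (cong₂ ℤ._*_ (χ-coset a m) (χ-coset a m)) (trans (values a) (sym (χ-coset a m)))
      where
      values : ∀ (a : Fin 4) → quarter (toℕ a) ℤ.* quarter (toℕ a) ≡ quarter (toℕ a)
      values 0F = refl
      values 1F = refl
      values 2F = refl
      values 3F = refl

  -- `common` is constant on each coset of the fourth powers; `common-ψ` joins the first two cosets
  -- and `common-β^3` the last two.
  common-shape : ∀ d → common d ≡ 1ℤ ℤ.* (+ 2 ℤ.* + r ℤ.* δ₀ d ℤ.+ λ₁ ℤ.* χ d) ℤ.+ (λ₁ ℤ.+ 1ℤ) ℤ.* χ′ d
  common-shape d with classify d
  ... | origin = begin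
    common 0#    ≡⟨ common-0 ⟩
    + 2 ℤ.* + r  ≡⟨ polynomial (+ 2 ℤ.* + r) λ₁ ⟩
    1ℤ ℤ.* (+ 2 ℤ.* + r ℤ.* 1ℤ ℤ.+ λ₁ ℤ.* 0ℤ) ℤ.+ (λ₁ ℤ.+ 1ℤ) ℤ.* 0ℤ
      ≡⟨ cong₂ (λ y z → 1ℤ ℤ.* (+ 2 ℤ.* + r ℤ.* y ℤ.+ λ₁ ℤ.* z) ℤ.+ (λ₁ ℤ.+ 1ℤ) ℤ.* 0ℤ) δ₀-0 χ-0 ⟨
    1ℤ ℤ.* (+ 2 ℤ.* + r ℤ.* δ₀ 0# ℤ.+ λ₁ ℤ.* χ 0#) ℤ.+ (λ₁ ℤ.+ 1ℤ) ℤ.* 0ℤ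
      ≡⟨ cong (λ z → 1ℤ ℤ.* (+ 2 ℤ.* + r ℤ.* δ₀ 0# ℤ.+ λ₁ ℤ.* χ 0#) ℤ.+ (λ₁ ℤ.+ 1ℤ) ℤ.* z) χ′-0 ⟨
    1ℤ ℤ.* (+ 2 ℤ.* + r ℤ.* δ₀ 0# ℤ.+ λ₁ ℤ.* χ 0#) ℤ.+ (λ₁ ℤ.+ 1ℤ) ℤ.* χ′ 0#
      ∎
    where
    polynomial : ∀ k l → k ≡ 1ℤ ℤ.* (k ℤ.* 1ℤ ℤ.+ l ℤ.* 0ℤ) ℤ.+ (l ℤ.+ 1ℤ) ℤ.* 0ℤ
    polynomial = solve-∀
  ... | coset a m = begin
    common x                    ≡⟨ common-fourthPower (toℕ a) m ⟩
    common (β ^ toℕ a)          ≡⟨ values a ⟩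
    1ℤ ℤ.* (+ 2 ℤ.* + r ℤ.* 0ℤ ℤ.+ λ₁ ℤ.* quarter (toℕ a)) ℤ.+ (λ₁ ℤ.+ 1ℤ) ℤ.* quarter (2 ℕ.+ toℕ a)
      ≡⟨ cong₂ (λ y z → 1ℤ ℤ.* (+ 2 ℤ.* + r ℤ.* y ℤ.+ λ₁ ℤ.* z) ℤ.+ (λ₁ ℤ.+ 1ℤ) ℤ.* quarter (2 ℕ.+ toℕ a)) (δ₀-off (coset≢0 (toℕ a ℕ.+ m ℕ.* 4))) (χ-coset a m) ⟨
    1ℤ ℤ.* (+ 2 ℤ.* + r ℤ.* δ₀ x ℤ.+ λ₁ ℤ.* χ x) ℤ.+ (λ₁ ℤ.+ 1ℤ) ℤ.* quarter (2 ℕ.+ toℕ a)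
      ≡⟨ cong (λ z → 1ℤ ℤ.* (+ 2 ℤ.* + r ℤ.* δ₀ x ℤ.+ λ₁ ℤ.* χ x) ℤ.+ (λ₁ ℤ.+ 1ℤ) ℤ.* z) (χ′-coset a m) ⟨
    1ℤ ℤ.* (+ 2 ℤ.* + r ℤ.* δ₀ x ℤ.+ λ₁ ℤ.* χ x) ℤ.+ (λ₁ ℤ.+ 1ℤ) ℤ.* χ′ x
      ∎
    where
    x : Carrier
    x = β ^ (toℕ a ℕ.+ m ℕ.* 4)
    edge : ∀ k l → l ≡ 1ℤ ℤ.* (k ℤ.* 0ℤ ℤ.+ l ℤ.* 1ℤ) ℤ.+ (l ℤ.+ 1ℤ) ℤ.* 0ℤ
    edge = solve-∀
    nonedge : ∀ k l → l ℤ.+ 1ℤ ≡ 1ℤ ℤ.* (k ℤ.* 0ℤ ℤ.+ l ℤ.* 0ℤ) ℤ.+ (l ℤ.+ 1ℤ) ℤ.* 1ℤ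
    nonedge = solve-∀
    values : ∀ (a : Fin 4) → common (β ^ toℕ a) ≡ 1ℤ ℤ.* (+ 2 ℤ.* + r ℤ.* 0ℤ ℤ.+ λ₁ ℤ.* quarter (toℕ a)) ℤ.+ (λ₁ ℤ.+ 1ℤ) ℤ.* quarter (2 ℕ.+ toℕ a)
    values 0F = edge (+ 2 ℤ.* + r) λ₁
    values 1F = trans (common-ψ 0) (edge (+ 2 ℤ.* + r) λ₁)
    values 2F = trans common-β^2 (nonedge (+ 2 ℤ.* + r) λ₁)
    values 3F = trans common-β^3 (trans common-β^2 (nonedge (+ 2 ℤ.* + r) λ₁))

  columnSum-χ : ∀ a → ∫ (λ x → χ (x - a)) ≡ + 2 ℤ.* + r
  columnSum-χ a = trans (∫-reindex (translation a) χ) ∫χ≡2r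

  -- Walks of length two from a vertex, counted by their middle vertex.
  ∫common : ∫ common ≡ + 2 ℤ.* + r ℤ.* (+ 2 ℤ.* + r)
  ∫common = begin
    ∫ common
      ≡⟨ ∙-congˡ 𝟙 (λ j → ∙-comm (χ ∘ elt) (λ i → χ (elt j - elt i))) ⟩
    𝟙 ∙ ((λ j i → χ (elt j - elt i)) · (χ ∘ elt))
      ≡⟨ ·-assoc {1} (λ _ → 𝟙) (λ j i → χ (elt j - elt i)) (χ ∘ elt) zero ⟩
    (λ i → ∫ (λ x → χ (x - elt i))) ∙ (χ ∘ elt)
      ≡⟨ ∙-comm _ (χ ∘ elt) ⟩
    (χ ∘ elt) ∙ (λ i → ∫ (λ x → χ (x - elt i)))
      ≡⟨ ∙-congˡ (χ ∘ elt) (λ i → trans (columnSum-χ (elt i)) (sym (ℤ.*-identityʳ (+ 2 ℤ.* + r)))) ⟩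
    (χ ∘ elt) ∙ (λ i → + 2 ℤ.* + r ℤ.* 𝟙 i)
      ≡⟨ ∙-scaleʳ (+ 2 ℤ.* + r) (χ ∘ elt) 𝟙 ⟩
    + 2 ℤ.* + r ℤ.* (χ ∘ elt) ∙ 𝟙
      ≡⟨ cong (+ 2 ℤ.* + r ℤ.*_) (trans (∙-comm (χ ∘ elt) 𝟙) ∫χ≡2r) ⟩
    + 2 ℤ.* + r ℤ.* (+ 2 ℤ.* + r)
      ∎

  -- Counting walks of length two by their endpoint gives k² = k + λ₁k + (λ₁ + 1)k with k = 2r,
  -- which determines λ₁ after cancelling 4r.
  λ₁≡r-1 : λ₁ ≡ + r ℤ.- 1ℤ
  λ₁≡r-1 = ℤ.*-cancelˡ-≡ (+ 4 ℤ.* + r) λ₁ (+ r ℤ.- 1ℤ) {{ℤ.i*j≢0 (+ 4) (+ r) {{_}} {{r≢0}}}} (begin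
    + 4 ℤ.* + r ℤ.* λ₁
      ≡⟨ isolate (+ r) λ₁ ⟩
    1ℤ ℤ.* (k ℤ.* 1ℤ ℤ.+ λ₁ ℤ.* k) ℤ.+ (λ₁ ℤ.+ 1ℤ) ℤ.* k ℤ.- + 4 ℤ.* + r
      ≡⟨ cong (ℤ._- + 4 ℤ.* + r) (trans (sym ∫shape) ∫common) ⟩
    k ℤ.* k ℤ.- + 4 ℤ.* + r
      ≡⟨ collect (+ r) ⟩
    + 4 ℤ.* + r ℤ.* (+ r ℤ.- 1ℤ)
      ∎)
    where
    k : ℤ
    k = + 2 ℤ.* + r
    isolate : ∀ r l → let k = + 2 ℤ.* r in + 4 ℤ.* r ℤ.* l ≡ 1ℤ ℤ.* (k ℤ.* 1ℤ ℤ.+ l ℤ.* k) ℤ.+ (l ℤ.+ 1ℤ) ℤ.* k ℤ.- + 4 ℤ.* r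
    isolate = solve-∀
    collect : ∀ r → let k = + 2 ℤ.* r in k ℤ.* k ℤ.- + 4 ℤ.* r ≡ + 4 ℤ.* r ℤ.* (r ℤ.- 1ℤ)
    collect = solve-∀
    ∫shape : ∫ common ≡ 1ℤ ℤ.* (k ℤ.* 1ℤ ℤ.+ λ₁ ℤ.* k) ℤ.+ (λ₁ ℤ.+ 1ℤ) ℤ.* k
    ∫shape = begin
      ∫ common
        ≡⟨ ∙-congˡ 𝟙 (common-shape ∘ elt) ⟩
      𝟙 ∙ (λ i → 1ℤ ℤ.* (k ℤ.* δ₀ (elt i) ℤ.+ λ₁ ℤ.* χ (elt i)) ℤ.+ (λ₁ ℤ.+ 1ℤ) ℤ.* χ′ (elt i))
        ≡⟨ ∙-linearʳ 1ℤ (λ₁ ℤ.+ 1ℤ) 𝟙 (λ i → k ℤ.* δ₀ (elt i) ℤ.+ λ₁ ℤ.* χ (elt i)) (χ′ ∘ elt) ⟩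
      1ℤ ℤ.* 𝟙 ∙ (λ i → k ℤ.* δ₀ (elt i) ℤ.+ λ₁ ℤ.* χ (elt i)) ℤ.+ (λ₁ ℤ.+ 1ℤ) ℤ.* ∫ χ′
        ≡⟨ cong₂ (λ y z → 1ℤ ℤ.* y ℤ.+ (λ₁ ℤ.+ 1ℤ) ℤ.* z) (∙-linearʳ k λ₁ 𝟙 (δ₀ ∘ elt) (χ ∘ elt)) ∫χ′≡2r ⟩
      1ℤ ℤ.* (k ℤ.* ∫ δ₀ ℤ.+ λ₁ ℤ.* ∫ χ) ℤ.+ (λ₁ ℤ.+ 1ℤ) ℤ.* k
        ≡⟨ cong₂ (λ y z → 1ℤ ℤ.* (k ℤ.* y ℤ.+ λ₁ ℤ.* z) ℤ.+ (λ₁ ℤ.+ 1ℤ) ℤ.* k) ∫δ₀ ∫χ≡2r ⟩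
      1ℤ ℤ.* (k ℤ.* 1ℤ ℤ.+ λ₁ ℤ.* k) ℤ.+ (λ₁ ℤ.+ 1ℤ) ℤ.* k
        ∎

  common≡ : ∀ d → common d ≡ 1ℤ ℤ.* (+ r ℤ.* δ₀ d ℤ.+ + r ℤ.* 1ℤ) ℤ.+ ℤ.- 1ℤ ℤ.* χ d
  common≡ d = begin
    common d
      ≡⟨ common-shape d ⟩
    1ℤ ℤ.* (+ 2 ℤ.* + r ℤ.* δ₀ d ℤ.+ λ₁ ℤ.* χ d) ℤ.+ (λ₁ ℤ.+ 1ℤ) ℤ.* χ′ d
      ≡⟨ cong₂ (λ l z → 1ℤ ℤ.* (+ 2 ℤ.* + r ℤ.* δ₀ d ℤ.+ l ℤ.* χ d) ℤ.+ (l ℤ.+ 1ℤ) ℤ.* z) λ₁≡r-1 (χ′-complement d) ⟩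
    1ℤ ℤ.* (+ 2 ℤ.* + r ℤ.* δ₀ d ℤ.+ (+ r ℤ.- 1ℤ) ℤ.* χ d) ℤ.+ (+ r ℤ.- 1ℤ ℤ.+ 1ℤ) ℤ.* (1ℤ ℤ.* 1ℤ ℤ.+ ℤ.- 1ℤ ℤ.* (1ℤ ℤ.* δ₀ d ℤ.+ 1ℤ ℤ.* χ d))
      ≡⟨ polynomial (+ r) (δ₀ d) (χ d) ⟩
    1ℤ ℤ.* (+ r ℤ.* δ₀ d ℤ.+ + r ℤ.* 1ℤ) ℤ.+ ℤ.- 1ℤ ℤ.* χ d
      ∎
    where
    polynomial : ∀ r δ x → 1ℤ ℤ.* (+ 2 ℤ.* r ℤ.* δ ℤ.+ (r ℤ.- 1ℤ) ℤ.* x) ℤ.+ (r ℤ.- 1ℤ ℤ.+ 1ℤ) ℤ.* (1ℤ ℤ.* 1ℤ ℤ.+ ℤ.- 1ℤ ℤ.* (1ℤ ℤ.* δ ℤ.+ 1ℤ ℤ.* x))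
      ≡ 1ℤ ℤ.* (r ℤ.* δ ℤ.+ r ℤ.* 1ℤ) ℤ.+ ℤ.- 1ℤ ℤ.* x
    polynomial = solve-∀

  -- From the indicator to the adjacency matrix

  C₀-β^ : ∀ m → C₀ (β ^ (m ℕ.* 4))
  C₀-β^ m = coset≢0 (m ℕ.* 4) , β ^ m , ^-assocʳ β m 4

  C₀⇒β^ : ∀ {x} → C₀ x → ∃[ m ] x ≡ β ^ (m ℕ.* 4)
  C₀⇒β^ {x} (x≢0 , y , y^4≡x) = log y y≢0 , (begin
    x                            ≡⟨ y^4≡x ⟨
    y ^ 4                        ≡⟨ cong (_^ 4) (β^log y y≢0) ⟨
    (β ^ log y y≢0) ^ 4          ≡⟨ ^-assocʳ β (log y y≢0) 4 ⟩
    β ^ (log y y≢0 ℕ.* 4)        ∎)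
    where
    y≢0 : y ≢ 0#
    y≢0 y≡0 = x≢0 (trans (sym y^4≡x) (trans (cong (_^ 4) y≡0) (0^ 4)))

  S′⇒χ≡1 : ∀ {x} → S' β x → χ x ≡ 1ℤ
  S′⇒χ≡1 (inj₁ c₀) with m , refl ← C₀⇒β^ c₀ = χ-coset 0F m
  S′⇒χ≡1 (inj₂ (c , c₀ , refl)) with m , refl ← C₀⇒β^ c₀ = χ-coset 1F m

  module _ {A} (isAdj : IsPeisertAdjMatrix β A) where
    A≡χ : ∀ i j → A i j ≡ χ (elt i - elt j)
    A≡χ i j = go (classify (elt i - elt j)) refl
      where
      nonadjacent : χ (elt i - elt j) ≡ 0ℤ → A i j ≡ χ (elt i - elt j)
      nonadjacent χ≡0 = trans (proj₂ (isAdj i j) λ (_ , s′) → contradiction (trans (sym (S′⇒χ≡1 s′)) χ≡0) λ ()) (sym χ≡0)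
      adjacent : S' β (elt i - elt j) → A i j ≡ χ (elt i - elt j)
      adjacent s′ = trans (proj₁ (isAdj i j) (≢ , s′)) (sym (S′⇒χ≡1 s′))
        where
        ≢ : elt i ≢ elt j
        ≢ eq = contradiction (begin
          1ℤ                     ≡⟨ S′⇒χ≡1 s′ ⟨
          χ (elt i - elt j)      ≡⟨ cong (λ x → χ (x - elt j)) eq ⟩
          χ (elt j - elt j)      ≡⟨ cong χ (R.-‿inverseʳ (elt j)) ⟩
          χ 0#                   ≡⟨ χ-0 ⟩
          0ℤ                     ∎) λ ()
      -- The difference is generalized to a variable d, so that the view can be matched on it.
      go : ∀ {d} → Class d → d ≡ elt i - elt j → A i j ≡ χ (elt i - elt j)
      go origin       eq = nonadjacent (trans (cong χ (sym eq)) χ-0)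
      go (coset 0F m) eq = adjacent (subst (S' β) eq (inj₁ (C₀-β^ m)))
      go (coset 1F m) eq = adjacent (subst (S' β) eq (inj₂ (β ^ (m ℕ.* 4) , C₀-β^ m , refl)))
      go (coset 2F m) eq = nonadjacent (trans (cong χ (sym eq)) (χ-coset 2F m))
      go (coset 3F m) eq = nonadjacent (trans (cong χ (sym eq)) (χ-coset 3F m))

    δ≡δ₀ : ∀ i k → δ₀ (elt i - elt k) ≡ δ i k
    δ≡δ₀ i k with i Fin.≟ k
    ... | yes refl = trans (cong δ₀ (R.-‿inverseʳ (elt i))) (trans δ₀-0 (sym (δ-diag i)))
    ... | no  i≢k  = trans (δ₀-off (i≢k ∘ elt-injective ∘ x∙y⁻¹≈ε⇒x≈y (elt i) (elt k))) (sym (δ-off i≢k))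

    conferenceGraph : ConferenceGraph A r
    conferenceGraph = record
      { order = q≡1+4r
      ; diagonal = λ i → trans (A≡χ i i) (trans (cong χ (R.-‿inverseʳ (elt i))) χ-0)
      ; rowSum = λ i → begin
          A i ∙ 𝟙                             ≡⟨ ∙-comm (A i) 𝟙 ⟩
          𝟙 ∙ A i                             ≡⟨ ∙-congˡ 𝟙 (A≡χ i) ⟩
          ∫ (λ x → χ (elt i - x))             ≡⟨ ∫-reindex (reflection (elt i)) χ ⟩
          ∫ χ                                 ≡⟨ ∫χ≡2r ⟩
          + 2 ℤ.* + r                         ∎
      ; columnSum = λ k → trans (∙-congˡ 𝟙 (λ j → A≡χ j k)) (columnSum-χ (elt k))
      ; square = λ i k → begin
          A i ∙ (λ j → A j k)
            ≡⟨ ∙-sum (A i) (λ j → A j k) ⟩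
          ∑[ j < q ] (A i j ℤ.* A j k)
            ≡⟨ sum-cong-≗ (λ j → cong₂ ℤ._*_ (A≡χ i j) (trans (A≡χ j k) (cong χ (sym ([a-b]-[a-x]≡x-b (elt i) (elt k) (elt j)))))) ⟩
          ∑[ j < q ] (χ (elt i - elt j) ℤ.* χ ((elt i - elt k) - (elt i - elt j)))
            ≡⟨ sum-reindex (reflection (elt i)) (λ w → χ w ℤ.* χ ((elt i - elt k) - w)) ⟩
          ∑[ j < q ] (χ (elt j) ℤ.* χ ((elt i - elt k) - elt j))
            ≡⟨ ⋆≡sum χ χ (elt i - elt k) ⟨
          common (elt i - elt k)
            ≡⟨ common≡ (elt i - elt k) ⟩
          1ℤ ℤ.* (+ r ℤ.* δ₀ (elt i - elt k) ℤ.+ + r ℤ.* 1ℤ) ℤ.+ ℤ.- 1ℤ ℤ.* χ (elt i - elt k)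
            ≡⟨ cong₂ (λ y z → 1ℤ ℤ.* (+ r ℤ.* y ℤ.+ + r ℤ.* 1ℤ) ℤ.+ ℤ.- 1ℤ ℤ.* z) (δ≡δ₀ i k) (sym (A≡χ i k)) ⟩
          1ℤ ℤ.* (+ r ℤ.* δ i k ℤ.+ + r ℤ.* 1ℤ) ℤ.+ ℤ.- 1ℤ ℤ.* A i k
            ∎
      }

-- The parameters θ and r

odd-power : ∀ p m₀ → p ≡ 3 ℕ.+ m₀ ℕ.* 4 → ∀ t → ∃[ θ ] p ℕ.^ t ≡ 1 ℕ.+ 2 ℕ.* θ
odd-power p m₀ p≡ zero    = 0 , refl
odd-power p m₀ p≡ (suc t) with θ , p^t≡ ← odd-power p m₀ p≡ t =
  suc (3 ℕ.* θ ℕ.+ 2 ℕ.* m₀ ℕ.+ 4 ℕ.* (m₀ ℕ.* θ)) , trans (cong₂ ℕ._*_ p≡ p^t≡) (expand m₀ θ)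
  where
  expand : ∀ m θ → (3 ℕ.+ m ℕ.* 4) ℕ.* (1 ℕ.+ 2 ℕ.* θ) ≡ 1 ℕ.+ 2 ℕ.* suc (3 ℕ.* θ ℕ.+ 2 ℕ.* m ℕ.+ 4 ℕ.* (m ℕ.* θ))
  expand = ℕ-Solver.solve-∀

-- Applied to r = θ(θ+1), this supplies the evenness that makes -1 a fourth power.
n*[1+n]-even : ∀ n → ∃[ h ] n ℕ.* suc n ≡ 2 ℕ.* h
n*[1+n]-even zero    = 0 , refl
n*[1+n]-even (suc n) with h , eq ← n*[1+n]-even n =
  suc n ℕ.+ h , trans (expand n) (trans (cong (2 ℕ.* suc n ℕ.+_) eq) (sym (ℕ.*-distribˡ-+ 2 (suc n) h)))
  where
  expand : ∀ n → suc n ℕ.* suc (suc n) ≡ 2 ℕ.* suc n ℕ.+ n ℕ.* suc n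
  expand = ℕ-Solver.solve-∀

open import Data.Nat using (_^_; _*_; _∸_; _/_; _%_; _≥_)

theorem3p1 : (p t : ℕ) → Prime p → p % 4 ≡ 3 → t ≥ 1 →
    (F : FiniteField (p ^ (2 * t))) → (β : FiniteField.Carrier F) →
    FiniteField.IsPrimitive F β →
    (A : Fin (p ^ (2 * t)) → Fin (p ^ (2 * t)) → ℤ) →
    FiniteField.IsPeisertAdjMatrix F β A →
    ∃ λ f → GroupMorphisms.IsGroupIsomorphism
    (Coker (p ^ (2 * t)) A) (Target ((p ^ (2 * t) ∸ 1) / 4)) f
theorem3p1 p t@(suc t-1) p-prime p%4≡3 _ F β primitive-β A isAdj =
  subst (λ k → ∃ λ f → GroupMorphisms.IsGroupIsomorphism (Coker q A) (Target k) f) (sym r≡)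
    (SmithGroup.f graph (+ θ) +r≡ , SmithGroup.f-isGroupIsomorphism graph (+ θ) +r≡)
  where
  q m₀ θ r : ℕ
  q = p ^ (2 * t)
  m₀ = p / 4
  p≡ : p ≡ 3 ℕ.+ m₀ * 4
  p≡ = trans (ℕ.m≡m%n+[m/n]*n p 4) (cong (ℕ._+ m₀ * 4) p%4≡3)
  -- θ = (p^t - 1)/2 is the nonnegative eigenvalue (√q - 1)/2. As t is a successor, θ and hence r
  -- are successors by computation, which settles the nonzero instance.
  θ = proj₁ (odd-power p m₀ p≡ t)
  r = θ * suc θ
  q≡ : q ≡ suc (4 * r)
  q≡ = begin
    p ^ (t ℕ.+ (t ℕ.+ 0))              ≡⟨ cong (λ k → p ^ (t ℕ.+ k)) (ℕ.+-identityʳ t) ⟩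
    p ^ (t ℕ.+ t)                      ≡⟨ ℕ.^-distribˡ-+-* p t t ⟩
    p ^ t * p ^ t                      ≡⟨ cong₂ _*_ p^t≡ p^t≡ ⟩
    (1 ℕ.+ 2 * θ) * (1 ℕ.+ 2 * θ)      ≡⟨ expand θ ⟩
    suc (4 * (θ * suc θ))              ∎
    where
    p^t≡ : p ^ t ≡ 1 ℕ.+ 2 * θ
    p^t≡ = proj₂ (odd-power p m₀ p≡ t)
    expand : ∀ θ → (1 ℕ.+ 2 * θ) * (1 ℕ.+ 2 * θ) ≡ suc (4 * (θ * suc θ))
    expand = ℕ-Solver.solve-∀
  r≡ : (q ∸ 1) / 4 ≡ r
  r≡ = trans (cong (λ k → (k ∸ 1) / 4) q≡) (trans (cong (_/ 4) (ℕ.*-comm 4 r)) (ℕ.m*n/n≡m r 4))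
  graph : ConferenceGraph A r
  -- The value of `e` is the predecessor of 2t in computed form, so q = p^(1+e) holds by `refl`.
  graph = PeisertGraph.conferenceGraph F primitive-β {h = proj₁ (n*[1+n]-even θ)}
            q≡ (proj₂ (n*[1+n]-even θ)) {e = t-1 ℕ.+ 1 * t} {m₀} p-prime refl p≡ isAdj
  +r≡ : + r ≡ + θ ℤ.* (+ θ ℤ.+ 1ℤ)
  +r≡ = trans (ℤ.pos-* θ (suc θ)) (cong (λ k → + θ ℤ.* + k) (ℕ.+-comm 1 θ))
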